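{- (1) For $\lambda\in[0,1)$, $\mathbb{L}^{>\lambda}(\mathrm{QBA}|\mathrm{D})$ is not closed under intersection. (2) For $\lambda\in[0,1)$, $\mathbb{L}^{>\lambda}(\mathrm{QBA}|\mathrm{D})$ is not closed under complementation (relative to $\Sigma^\omega$).
   Context: A quantum automaton is a tuple $\mathcal{A}=(\mathcal{H},|s_0\rangle,\Sigma,\{U_\sigma:\sigma\in\Sigma\},F)$ where $\mathcal{H}$ is a finite-dimensional complex Hilbert space, $|s_0\rangle$ a unit vector, $\Sigma$ a finite alphabet, each $U_\sigma$ unitary, and $F$ a subspace. For $w=\sigma_1\sigma_2\cdots\in\Sigma^\omega$, a unit vector $|\psi\rangle\in F$ and checkpoints $0\le n_1<n_2<\cdots$, the disturbing run is $|s_0\rangle$ and for $n\ge1$: $|s_n\rangle=U_{\sigma_n}|\psi\rangle$ if $n-1=n_i$ for some $i$, else $|s_n\rangle=U_{\sigma_n}|s_{n-1}\rangle$; $f^{\mathrm{D}}_{\mathcal{A}}(w)=\sup_{|\psi\rangle}\sup_{\{n_i\}}\inf_{i\ge1}|\langle\psi|s_{n_i}\rangle|^2$ over unit $|\psi\rangle\in F$ and strictly increasing checkpoint sequences. $\mathcal{L}^{>\lambda}(\mathcal{A}|\mathrm{D})=\{w:f^{\mathrm{D}}_{\mathcal{A}}(w)>\lambda\}$ and $\mathbb{L}^{>\lambda}(\mathrm{QBA}|\mathrm{D})$ is the class of all such languages over all quantum automata. -}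

module Defs where

open import Algebra.Bundles using (CommutativeRing; Ring)
import Algebra.Definitions.RawMonoid as RawMonoidDefinitions
open import Algebra.Module.Bundles using (LeftModule)
open import Algebra.Module.Morphism.Structures using (module LeftModuleMorphisms)
import Algebra.Properties.Ring as RingProperties
import Algebra.Solver.Ring.NaturalCoefficients.Default as SemiringSolver
open import Data.Bool.Base using (if_then_else_)
open import Data.Fin.Base using (Fin)
open import Data.Nat.Base as ℕ using (ℕ; zero; suc)
import Data.Nat.Properties as ℕ
open import Data.Product.Base using (Σ; ∃; _×_; _,_)
open import Data.Sum.Base using (_⊎_)
open import Level using (0ℓ)
open import Relation.Binary.Core using (Rel)
open import Relation.Binary.PropositionalEquality.Core using (_≡_; refl)
open import Relation.Binary.Structures using (IsStrictTotalOrder)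
open import Relation.Nullary.Decidable.Core using (Dec; does; map′)
open import Relation.Unary using (Pred; _∩_; ∁; _≐_)

-- The axioms characterising ℝ up to isomorphism.  The standard library has no
-- real numbers, so everything below is developed over an arbitrary model.
-- Equality is the setoid equality of the ring.
record CompleteOrderedField : Set₁ where
  field
    commutativeRing : CommutativeRing 0ℓ 0ℓ

  open CommutativeRing commutativeRing public

  infix 4 _<_ _≤_

  field
    _<_                : Rel Carrier 0ℓ
    isStrictTotalOrder : IsStrictTotalOrder _≈_ _<_

  _≤_ : Rel Carrier 0ℓ
  x ≤ y = x < y ⊎ x ≈ y

  IsUpperBound : Pred Carrier 0ℓ → Carrier → Set
  IsUpperBound S b = ∀ {x} → S x → x ≤ b

  IsLowerBound : Pred Carrier 0ℓ → Carrier → Set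
  IsLowerBound S b = ∀ {x} → S x → b ≤ x

  IsSupremum : Pred Carrier 0ℓ → Carrier → Set
  IsSupremum S s = IsUpperBound S s × (∀ {b} → IsUpperBound S b → s ≤ b)

  IsInfimum : Pred Carrier 0ℓ → Carrier → Set
  IsInfimum S s = IsLowerBound S s × (∀ {b} → IsLowerBound S b → b ≤ s)

  field
    0<1      : 0# < 1#
    +-mono-< : ∀ {x y} z → x < y → x + z < y + z
    *-pos    : ∀ {x y} → 0# < x → 0# < y → 0# < x * y
    inverse  : ∀ {x} → x ≉ 0# → ∃ λ y → x * y ≈ 1#
    complete : (S : Pred Carrier 0ℓ) → ∃ S → ∃ (IsUpperBound S) → ∃ (IsSupremum S)

module Complex (ℝ : CompleteOrderedField) where
  private
    module R = CompleteOrderedField ℝ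
    open R using (_+_; _*_; -_; _-_; 0#; 1#)
    open SemiringSolver R.commutativeSemiring
      using (solve; _:=_; _:+_; _:*_; con)

    -- The ring laws of ℂ are checked by a semiring solver, with -1 as a variable.
    m : R.Carrier
    m = - 1#

    sub : ∀ {x y} → x - y R.≈ x + m * y
    sub = R.+-congˡ (R.sym (RingProperties.-1*x≈-x R.ring _))

  record ℂ : Set where
    constructor _+i_
    field
      re im : R.Carrier

  open ℂ public

  infix 4 _≈ℂ_
  record _≈ℂ_ (z w : ℂ) : Set where
    constructor _,_
    field
      re≈ : re z R.≈ re w
      im≈ : im z R.≈ im w

  infixl 6 _+ℂ_
  infixl 7 _*ℂ_
  infix 8 -ℂ_

  _+ℂ_ _*ℂ_ : ℂ → ℂ → ℂ
  (a +i b) +ℂ (c +i d) = (a + c) +i (b + d)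
  (a +i b) *ℂ (c +i d) = (a * c - b * d) +i (a * d + b * c)

  -ℂ_ conj : ℂ → ℂ
  -ℂ (a +i b)  = (- a) +i (- b)
  conj (a +i b) = a +i (- b)

  0ℂ 1ℂ : ℂ
  0ℂ = 0# +i 0#
  1ℂ = 1# +i 0#

  ∣_∣² : ℂ → R.Carrier
  ∣ a +i b ∣² = a * a + b * b

  ℂ-commutativeRing : CommutativeRing 0ℓ 0ℓ
  ℂ-commutativeRing = record
    { Carrier = ℂ ; _≈_ = _≈ℂ_ ; _+_ = _+ℂ_ ; _*_ = _*ℂ_ ; -_ = -ℂ_ ; 0# = 0ℂ ; 1# = 1ℂ
    ; isCommutativeRing = record
      { isRing = record
        { +-isAbelianGroup = record
          { isGroup = record
            { isMonoid = record
              { isSemigroup = record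
                { isMagma = record
                  { isEquivalence = record
                    { refl  = R.refl , R.refl
                    ; sym   = λ (p , q) → R.sym p , R.sym q
                    ; trans = λ (p , q) (p′ , q′) → R.trans p p′ , R.trans q q′
                    }
                  ; ∙-cong = λ (p , q) (p′ , q′) → R.+-cong p p′ , R.+-cong q q′
                  }
                ; assoc = λ _ _ _ → R.+-assoc _ _ _ , R.+-assoc _ _ _
                }
              ; identity = (λ _ → R.+-identityˡ _ , R.+-identityˡ _)
                         , (λ _ → R.+-identityʳ _ , R.+-identityʳ _)
              }
            ; inverse = (λ _ → R.-‿inverseˡ _ , R.-‿inverseˡ _)
                      , (λ _ → R.-‿inverseʳ _ , R.-‿inverseʳ _)
            ; ⁻¹-cong = λ (p , q) → R.-‿cong p , R.-‿cong q
            }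
          ; comm = λ _ _ → R.+-comm _ _ , R.+-comm _ _
          }
        ; *-cong = λ (p , q) (p′ , q′) →
            R.+-cong (R.*-cong p p′) (R.-‿cong (R.*-cong q q′)) ,
            R.+-cong (R.*-cong p q′) (R.*-cong q p′)
        ; *-assoc = λ (a +i b) (c +i d) (e +i f) →
            R.trans (R.trans sub (R.+-congʳ (R.*-congʳ sub)))
              (R.trans
                (solve 7 (λ a b c d e f m →
                  (a :* c :+ m :* (b :* d)) :* e :+ m :* ((a :* d :+ b :* c) :* f) :=
                  a :* (c :* e :+ m :* (d :* f)) :+ m :* (b :* (c :* f :+ d :* e)))
                  R.refl a b c d e f m)
                (R.sym (R.trans sub (R.+-congʳ (R.*-congˡ sub))))) ,
            R.trans (R.+-congʳ (R.*-congʳ sub))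
              (R.trans
                (solve 7 (λ a b c d e f m →
                  (a :* c :+ m :* (b :* d)) :* f :+ (a :* d :+ b :* c) :* e :=
                  a :* (c :* f :+ d :* e) :+ b :* (c :* e :+ m :* (d :* f)))
                  R.refl a b c d e f m)
                (R.sym (R.+-congˡ (R.*-congˡ sub))))
        ; *-identity =
            (λ (a +i b) →
              R.trans sub (solve 3 (λ a b m →
                con 1 :* a :+ m :* (con 0 :* b) := a) R.refl a b m) ,
              solve 2 (λ a b → con 1 :* b :+ con 0 :* a := b) R.refl a b) ,
            (λ (a +i b) →
              R.trans sub (solve 3 (λ a b m →
                a :* con 1 :+ m :* (b :* con 0) := a) R.refl a b m) ,
              solve 2 (λ a b → a :* con 0 :+ b :* con 1 := b) R.refl a b)
        ; distrib =
            (λ (a +i b) (c +i d) (e +i f) →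
              R.trans sub (R.trans
                (solve 7 (λ a b c d e f m →
                  a :* (c :+ e) :+ m :* (b :* (d :+ f)) :=
                  (a :* c :+ m :* (b :* d)) :+ (a :* e :+ m :* (b :* f)))
                  R.refl a b c d e f m)
                (R.sym (R.+-cong sub sub))) ,
              solve 6 (λ a b c d e f →
                a :* (d :+ f) :+ b :* (c :+ e) :=
                (a :* d :+ b :* c) :+ (a :* f :+ b :* e)) R.refl a b c d e f) ,
            (λ (a +i b) (c +i d) (e +i f) →
              R.trans sub (R.trans
                (solve 7 (λ a b c d e f m →
                  (c :+ e) :* a :+ m :* ((d :+ f) :* b) :=
                  (c :* a :+ m :* (d :* b)) :+ (e :* a :+ m :* (f :* b)))
                  R.refl a b c d e f m)
                (R.sym (R.+-cong sub sub))) ,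
              solve 6 (λ a b c d e f →
                (c :+ e) :* b :+ (d :+ f) :* a :=
                (c :* b :+ d :* a) :+ (e :* b :+ f :* a)) R.refl a b c d e f)
        }
      ; *-comm = λ (a +i b) (c +i d) →
          R.+-cong (R.*-comm a c) (R.-‿cong (R.*-comm b d)) ,
          solve 4 (λ a b c d → a :* d :+ b :* c := c :* b :+ d :* a) R.refl a b c d
      }
    }

  ℂ-ring : Ring 0ℓ 0ℓ
  ℂ-ring = CommutativeRing.ring ℂ-commutativeRing

-- Checkpoints n₁ < n₂ < ⋯ , with nᵢ stored as at (i ∸ 1).
record Checkpoints : Set where
  field
    at         : ℕ → ℕ
    increasing : ∀ i → at i ℕ.< at (suc i)

  IsCheckpoint : Pred ℕ 0ℓ
  IsCheckpoint n = ∃ λ i → at i ≡ n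

  i≤at : ∀ i → i ℕ.≤ at i
  i≤at zero    = ℕ.z≤n
  i≤at (suc i) = ℕ.≤-<-trans (i≤at i) (increasing i)

  isCheckpoint? : ∀ n → Dec (IsCheckpoint n)
  isCheckpoint? n =
    map′ (λ (i , _ , p) → i , p)
         (λ { (i , refl) → i , ℕ.s≤s (i≤at i) , refl })
         (ℕ.anyUpTo? (λ i → at i ℕ.≟ n) (suc n))

-- An infinite word σ₁σ₂⋯ over a k-letter alphabet; σₙ is w (n ∸ 1).
Word : ℕ → Set
Word k = ℕ → Fin k

Language : ℕ → Set₁
Language k = Pred (Word k) 0ℓ

LanguageClass : Set₂
LanguageClass = ∀ {k} → Language k → Set₁

ClosedUnderIntersection : LanguageClass → Set₁
ClosedUnderIntersection 𝒞 =
  ∀ {k} (L₁ L₂ : Language k) → 𝒞 L₁ → 𝒞 L₂ → 𝒞 (L₁ ∩ L₂)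

ClosedUnderComplementation : LanguageClass → Set₁
ClosedUnderComplementation 𝒞 = ∀ {k} (L : Language k) → 𝒞 L → 𝒞 (∁ L)

module Quantum (ℝ : CompleteOrderedField) where
  open CompleteOrderedField ℝ
    using (IsSupremum; IsInfimum; _≤_; _<_; 0#)
    renaming (Carrier to Real; _≈_ to _≈ℝ_)
  open Complex ℝ public

  -- Inner products are conjugate-linear in the first argument and linear in the
  -- second.  Metric completeness is not a field because it is automatic in
  -- finite dimension.
  record FiniteDimensionalHilbertSpace : Set₁ where
    field
      vectorSpace : LeftModule ℂ-ring 0ℓ 0ℓ

    open LeftModule vectorSpace public
      renaming (Carrierᴹ to Vector)

    open RawMonoidDefinitions +ᴹ-rawMonoid public
      using (sum)

    field
      ⟨_∣_⟩        : Vector → Vector → ℂ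
      ⟨∣⟩-cong     : ∀ {x x′ y y′} → x ≈ᴹ x′ → y ≈ᴹ y′ → ⟨ x ∣ y ⟩ ≈ℂ ⟨ x′ ∣ y′ ⟩
      ⟨∣⟩-+        : ∀ x y z → ⟨ x ∣ y +ᴹ z ⟩ ≈ℂ ⟨ x ∣ y ⟩ +ℂ ⟨ x ∣ z ⟩
      ⟨∣⟩-*        : ∀ x c y → ⟨ x ∣ c *ₗ y ⟩ ≈ℂ c *ℂ ⟨ x ∣ y ⟩
      ⟨∣⟩-conj     : ∀ x y → ⟨ y ∣ x ⟩ ≈ℂ conj ⟨ x ∣ y ⟩
      ⟨∣⟩-nonneg   : ∀ x → 0# ≤ re ⟨ x ∣ x ⟩
      ⟨∣⟩-definite : ∀ {x} → ⟨ x ∣ x ⟩ ≈ℂ 0ℂ → x ≈ᴹ 0ᴹ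
      finitelySpanned :
        ∃ λ n → Σ (Fin n → Vector) λ b →
          ∀ x → Σ (Fin n → ℂ) λ c → x ≈ᴹ sum (λ i → c i *ₗ b i)

    IsUnit : Pred Vector 0ℓ
    IsUnit x = ⟨ x ∣ x ⟩ ≈ℂ 1ℂ

  module _ (H : FiniteDimensionalHilbertSpace) where
    open FiniteDimensionalHilbertSpace H
    open LeftModuleMorphisms rawLeftModule rawLeftModule

    record Unitary : Set where
      field
        apply adjoint : Vector → Vector
        linear        : IsLeftModuleHomomorphism apply
        isAdjoint     : ∀ x y → ⟨ adjoint x ∣ y ⟩ ≈ℂ ⟨ x ∣ apply y ⟩
        adjoint-apply : ∀ x → adjoint (apply x) ≈ᴹ x
        apply-adjoint : ∀ x → apply (adjoint x) ≈ᴹ x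

    record Subspace : Set₁ where
      field
        contains : Pred Vector 0ℓ
        resp-≈ᴹ  : ∀ {x y} → x ≈ᴹ y → contains x → contains y
        has-0ᴹ   : contains 0ᴹ
        +ᴹ-closed : ∀ {x y} → contains x → contains y → contains (x +ᴹ y)
        *ₗ-closed : ∀ c {x} → contains x → contains (c *ₗ x)

  record QuantumAutomaton (k : ℕ) : Set₁ where
    field
      H       : FiniteDimensionalHilbertSpace

    open FiniteDimensionalHilbertSpace H public

    field
      s₀      : Vector
      s₀-unit : IsUnit s₀
      U       : Fin k → Unitary H
      F       : Subspace H

    disturbingRun : Word k → Vector → Checkpoints → ℕ → Vector
    disturbingRun w ψ c zero    = s₀
    disturbingRun w ψ c (suc n) =
      Unitary.apply (U (w n))
        (if does (Checkpoints.isCheckpoint? c n) then ψ else disturbingRun w ψ c n)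

    returnProbability : Word k → Vector → Checkpoints → ℕ → Real
    returnProbability w ψ c i = ∣ ⟨ ψ ∣ disturbingRun w ψ c (Checkpoints.at c i) ⟩ ∣²

    -- IsValue w v is the graph "v is the value of w under disturbing runs".
    -- Adjoining 0 to the outer set changes nothing when F has a unit vector, all
    -- values being in [0,1]; it makes the supremum 0 when F = {0}.
    IsValue : Word k → Real → Set
    IsValue w = IsSupremum λ a →
      (a ≈ℝ 0#) ⊎
      (∃ λ ψ → Subspace.contains F ψ × IsUnit ψ ×
        IsSupremum (λ b → Σ Checkpoints λ c →
          IsInfimum (λ p → ∃ λ i → p ≈ℝ returnProbability w ψ c i) b) a)

    language^> : Real → Language k
    language^> cut w = ∃ λ v → IsValue w v × cut < v

  QBA-D^> : Real → LanguageClass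
  QBA-D^> cut {k} L = Σ (QuantumAutomaton k) λ A → L ≐ QuantumAutomaton.language^> A cut

{-# OPTIONS --safe #-}
module Submission where

-- A unitary on a finite-dimensional space is recurrent: the orbit of a unit vector ψ is confined to a
-- totally bounded set, so some power of U nearly fixes ψ.  Hence if w is accepted with first checkpoint n,
-- then the word that follows w up to n and repeats any one letter x afterwards is accepted too, with the
-- same ψ.  On ℂ² let the letter 0 exchange the basis vectors and the letter 1 act trivially, and let L_q be
-- the language of the automaton started in e₀ with F spanned by e_q.  Then 0^ω lies in L₀ ∩ L₁ but no
-- 0ⁿ1^ω does, and 1^ω lies in the complement of L₁ but no 1ⁿ0^ω does.
-- Since every goal is a negation, existence statements are only needed up to double negation.

-- A checkpoint resets the state to ψ and erases the past. For fixed ψ, the first return probability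
-- depends only on the letters before the first checkpoint, and each later one only on the letters
-- between two consecutive checkpoints. With a constant tail and equal gaps the later ones all
-- coincide, so a single good exponent serves them all. Recurrence brings the overlap close to 1
-- without attaining it, which is where the cut must lie below 1; a cut of at least 0 makes a
-- vanishing overlap reject. The two languages count the letter 0 modulo 2: L_q holds the words with
-- infinitely many prefixes in which the number of 0s has parity q. The word 0^ω alternates between
-- the parities, whereas a tail of 1s freezes the parity. Square roots are avoided throughout: only
-- squared norms are compared, and projections divide by a squared norm. Compactness enters as a
-- finite colouring of the unit ball in which equal colours force closeness, so that the pigeonhole
-- principle replaces convergent subsequences.

open import Algebra.Bundles using (CommutativeMonoid; CommutativeRing; RawRing)
import Algebra.Module.Construct.DirectProduct as DirectProduct
import Algebra.Module.Construct.TensorUnit as TensorUnit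
import Algebra.Properties.CommutativeSemigroup as CommutativeSemigroupProperties
import Algebra.Properties.Ring as RingProperties
import Algebra.Properties.Semiring.Mult as SemiringMultiples
import Algebra.Properties.Semiring.Mult.TCOptimised as Multiples
import Algebra.Solver.Ring as RingSolver
open import Algebra.Solver.Ring.AlmostCommutativeRing using (fromCommutativeRing; _-Raw-AlmostCommutative⟶_)
import Algebra.Solver.Ring.NaturalCoefficients.Default as SemiringSolver
open import Data.Bool.Base using (Bool; true; false; not; if_then_else_)
import Data.Bool.Properties as Bool
open import Data.Fin.Base using (Fin; zero; suc; toℕ; combine)
open import Data.Fin.Properties using (suc-injective; combine-injective; pigeonhole)
open import Data.Maybe.Base using (Maybe; map)
open import Data.Nat.Base as ℕ using (ℕ; zero; suc)
import Data.Nat.Properties as ℕ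
open import Data.Product.Base using (∃; Σ; _×_; _,_; proj₁; proj₂; swap)
open import Data.Product.Properties using (≡-dec)
open import Data.Sum.Base using (inj₁; inj₂)
open import Defs
open import Function.Base using (id; _∘_)
open import Level using (0ℓ)
open import Relation.Binary.Bundles using (StrictPartialOrder)
open import Relation.Binary.Consequences using (dec⇒weaklyDec)
import Relation.Binary.Construct.StrictToNonStrict as StrictToNonStrict
open import Relation.Binary.Definitions using (tri<; tri≈; tri>)
open import Relation.Binary.PropositionalEquality as ≡ using (_≡_; module ≡-Reasoning)
import Relation.Binary.Reasoning.Setoid as SetoidReasoning
import Relation.Binary.Reasoning.StrictPartialOrder as StrictReasoning
open import Relation.Binary.Structures using (IsStrictTotalOrder; IsTotalOrder)
open import Relation.Nullary.Decidable using (does; dec-true; dec-false; yes; no)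
open import Relation.Nullary.Negation.Core using (¬_; contradiction)
open import Relation.Unary using (Pred)

-- A ring solver with integer coefficients

-- The pair (m , n) stands for the coefficient m - n.
module IntegerCoefficients {c ℓ} (R : CommutativeRing c ℓ) where
  open CommutativeRing R hiding (zero)
  open RingProperties ring using (-1*x≈-x; -‿involutive)
  open Multiples semiring renaming (_×_ to _·_; ×-homo-+ to ·-homo-+; ×1-homo-* to ·1-homo-*) using ()
  open SetoidReasoning setoid
  private
    module S = SemiringSolver commutativeSemiring
    open S using (_:=_; _:+_; _:*_)

    -- Minus one as an atom: the semiring solver sees no negation, so signs are carried by `κ` and
    -- `κ*κ≈1` is applied by hand.
    κ : Carrier
    κ = - 1#

    κ*κ≈1 : κ * κ ≈ 1#
    κ*κ≈1 = trans (-1*x≈-x κ) (-‿involutive 1#)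

    -- The separate clause for `zero` makes `con (0 , 0)` and `con (1 , 0)` evaluate definitionally
    -- to `0#` and `1#`, the form in which they occur in goals.
    value : ℕ × ℕ → Carrier
    value (m , zero)  = m · 1#
    value (m , suc n) = m · 1# - suc n · 1#

    value≈ : ∀ m n → value (m , n) ≈ m · 1# + κ * (n · 1#)
    value≈ m zero    = sym (trans (+-congˡ (zeroʳ κ)) (+-identityʳ _))
    value≈ m (suc n) = +-congˡ (sym (-1*x≈-x _))

    -- The solver compares normal forms syntactically, so coefficients must be kept reduced.
    reduce : ℕ → ℕ → ℕ × ℕ
    reduce (suc m) (suc n) = reduce m n
    reduce m       n       = m , n

    value-reduce : ∀ m n → value (reduce m n) ≈ m · 1# + κ * (n · 1#)
    value-reduce zero    n       = value≈ zero n
    value-reduce (suc m) zero    = value≈ (suc m) zero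
    value-reduce (suc m) (suc n) = begin
      value (reduce m n)
        ≈⟨ value-reduce m n ⟩
      m · 1# + κ * (n · 1#)
        ≈⟨ +-identityˡ _ ⟨
      0# + (m · 1# + κ * (n · 1#))
        ≈⟨ +-congʳ (-‿inverseʳ 1#) ⟨
      (1# + κ) + (m · 1# + κ * (n · 1#))
        ≈⟨ S.solve 3 (λ k a b →
             (S.con 1 :+ k) :+ (a :+ k :* b) := (S.con 1 :+ a) :+ k :* (S.con 1 :+ b))
             refl κ (m · 1#) (n · 1#) ⟩
      (1# + m · 1#) + κ * (1# + n · 1#)
        ≈⟨ +-cong (·-homo-+ 1# 1 m) (*-congˡ (·-homo-+ 1# 1 n)) ⟨
      suc m · 1# + κ * (suc n · 1#) ∎

    coefficients : RawRing _ _
    coefficients = record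
      { Carrier = ℕ × ℕ
      ; _≈_     = _≡_
      ; _+_     = λ (m , n) (m′ , n′) → reduce (m ℕ.+ m′) (n ℕ.+ n′)
      ; _*_     = λ (m , n) (m′ , n′) → reduce (m ℕ.* m′ ℕ.+ n ℕ.* n′) (m ℕ.* n′ ℕ.+ n ℕ.* m′)
      ; -_      = λ (m , n) → n , m
      ; 0#      = 0 , 0
      ; 1#      = 1 , 0
      }

    homomorphism : coefficients -Raw-AlmostCommutative⟶ fromCommutativeRing R
    homomorphism = record
      { ⟦_⟧    = value
      ; +-homo = λ (m , n) (m′ , n′) → begin
          value (reduce (m ℕ.+ m′) (n ℕ.+ n′))
            ≈⟨ value-reduce (m ℕ.+ m′) (n ℕ.+ n′) ⟩
          (m ℕ.+ m′) · 1# + κ * ((n ℕ.+ n′) · 1#)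
            ≈⟨ +-cong (·-homo-+ 1# m m′) (*-congˡ (·-homo-+ 1# n n′)) ⟩
          (m · 1# + m′ · 1#) + κ * (n · 1# + n′ · 1#)
            ≈⟨ S.solve 5 (λ k a b a′ b′ → (a :+ a′) :+ k :* (b :+ b′) := (a :+ k :* b) :+ (a′ :+ k :* b′))
                 refl κ (m · 1#) (n · 1#) (m′ · 1#) (n′ · 1#) ⟩
          (m · 1# + κ * (n · 1#)) + (m′ · 1# + κ * (n′ · 1#))
            ≈⟨ +-cong (value≈ m n) (value≈ m′ n′) ⟨
          value (m , n) + value (m′ , n′) ∎
      ; *-homo = λ (m , n) (m′ , n′) → begin
          value (reduce (m ℕ.* m′ ℕ.+ n ℕ.* n′) (m ℕ.* n′ ℕ.+ n ℕ.* m′))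
            ≈⟨ value-reduce (m ℕ.* m′ ℕ.+ n ℕ.* n′) (m ℕ.* n′ ℕ.+ n ℕ.* m′) ⟩
          (m ℕ.* m′ ℕ.+ n ℕ.* n′) · 1# + κ * ((m ℕ.* n′ ℕ.+ n ℕ.* m′) · 1#)
            ≈⟨ +-cong (sum-of-products m m′ n n′) (*-congˡ (sum-of-products m n′ n m′)) ⟩
          (m · 1# * (m′ · 1#) + n · 1# * (n′ · 1#)) + κ * (m · 1# * (n′ · 1#) + n · 1# * (m′ · 1#))
            ≈⟨ +-congʳ (+-congˡ (trans (*-congʳ κ*κ≈1) (*-identityˡ _))) ⟨
          (m · 1# * (m′ · 1#) + κ * κ * (n · 1# * (n′ · 1#))) + κ * (m · 1# * (n′ · 1#) + n · 1# * (m′ · 1#))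
            ≈⟨ S.solve 5 (λ k a b a′ b′ →
                   (a :* a′ :+ k :* k :* (b :* b′)) :+ k :* (a :* b′ :+ b :* a′) :=
                   (a :+ k :* b) :* (a′ :+ k :* b′))
                 refl κ (m · 1#) (n · 1#) (m′ · 1#) (n′ · 1#) ⟩
          (m · 1# + κ * (n · 1#)) * (m′ · 1# + κ * (n′ · 1#))
            ≈⟨ *-cong (value≈ m n) (value≈ m′ n′) ⟨
          value (m , n) * value (m′ , n′) ∎
      ; -‿homo = λ (m , n) → begin
          value (n , m)
            ≈⟨ value≈ n m ⟩
          n · 1# + κ * (m · 1#)
            ≈⟨ +-congʳ (trans (*-congʳ κ*κ≈1) (*-identityˡ _)) ⟨
          κ * κ * (n · 1#) + κ * (m · 1#)
            ≈⟨ S.solve 3 (λ k a b → k :* k :* b :+ k :* a := k :* (a :+ k :* b))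
                 refl κ (m · 1#) (n · 1#) ⟩
          κ * (m · 1# + κ * (n · 1#))
            ≈⟨ -1*x≈-x _ ⟩
          - (m · 1# + κ * (n · 1#))
            ≈⟨ -‿cong (value≈ m n) ⟨
          - value (m , n) ∎
      ; 0-homo = refl
      ; 1-homo = refl
      }
      where
      sum-of-products : ∀ m m′ n n′ →
        (m ℕ.* m′ ℕ.+ n ℕ.* n′) · 1# ≈ m · 1# * (m′ · 1#) + n · 1# * (n′ · 1#)
      sum-of-products m m′ n n′ =
        trans (·-homo-+ 1# (m ℕ.* m′) (n ℕ.* n′)) (+-cong (·1-homo-* m m′) (·1-homo-* n n′))

    equal : ∀ p q → Maybe (value p ≈ value q)
    equal p q = map (λ p≡q → reflexive (≡.cong value p≡q)) (dec⇒weaklyDec (≡-dec ℕ._≟_ ℕ._≟_) p q)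

  open RingSolver coefficients (fromCommutativeRing R) homomorphism equal public
    using (solve; _:=_; _:+_; _:*_; _:-_; :-_; con; Polynomial)

-- Ordered field arithmetic, suprema, and finite colourings of bounded sets of reals

module OrderedField (ℝ : CompleteOrderedField) where
  open CompleteOrderedField ℝ hiding (zero)
  open IntegerCoefficients commutativeRing
  open SemiringMultiples semiring using () renaming (_×_ to _·_)
  open IsStrictTotalOrder isStrictTotalOrder public
    using (isStrictPartialOrder; compare; _<?_)
    renaming (irrefl to <-irrefl)
  open IsTotalOrder (StrictToNonStrict.isTotalOrder _≈_ _<_ isStrictTotalOrder) public
    using () renaming (refl to ≤-refl; reflexive to ≤-reflexive; trans to ≤-trans; total to ≤-total)

  strictPartialOrder : StrictPartialOrder 0ℓ 0ℓ 0ℓ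
  strictPartialOrder = record { isStrictPartialOrder = isStrictPartialOrder }

  module ≤-Reasoning = StrictReasoning strictPartialOrder
  open ≤-Reasoning

  ≮⇒≥ : ∀ {x y} → ¬ x < y → y ≤ x
  ≮⇒≥ {x} {y} x≮y with compare x y
  ... | tri< x<y _ _ = contradiction x<y x≮y
  ... | tri≈ _ x≈y _ = inj₂ (sym x≈y)
  ... | tri> _ _ y<x = inj₁ y<x

  <⇒≱ : ∀ {x y} → x < y → ¬ y ≤ x
  <⇒≱ {x} {y} x<y y≤x = <-irrefl refl (begin-strict x <⟨ x<y ⟩ y ≤⟨ y≤x ⟩ x ∎)

  +-monoˡ-≤ : ∀ {x y} z → x ≤ y → x + z ≤ y + z
  +-monoˡ-≤ z (inj₁ x<y) = inj₁ (+-mono-< z x<y)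
  +-monoˡ-≤ z (inj₂ x≈y) = inj₂ (+-congʳ x≈y)

  +-mono-≤ : ∀ {x y u v} → x ≤ y → u ≤ v → x + u ≤ y + v
  +-mono-≤ {x} {y} {u} {v} x≤y u≤v = begin
    x + u ≤⟨ +-monoˡ-≤ u x≤y ⟩
    y + u ≈⟨ +-comm y u ⟩
    u + y ≤⟨ +-monoˡ-≤ y u≤v ⟩
    v + y ≈⟨ +-comm v y ⟩
    y + v ∎

  0≤y-x⇒x≤y : ∀ {x y} → 0# ≤ y - x → x ≤ y
  0≤y-x⇒x≤y {x} {y} 0≤y-x = begin
    x           ≈⟨ +-identityˡ x ⟨
    0# + x      ≤⟨ +-monoˡ-≤ x 0≤y-x ⟩
    (y - x) + x ≈⟨ solve 2 (λ x y → (y :- x) :+ x := y) refl x y ⟩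
    y           ∎

  x≤y⇒0≤y-x : ∀ {x y} → x ≤ y → 0# ≤ y - x
  x≤y⇒0≤y-x {x} {y} x≤y = begin
    0#    ≈⟨ -‿inverseʳ x ⟨
    x - x ≤⟨ +-monoˡ-≤ (- x) x≤y ⟩
    y - x ∎

  x<y⇒0<y-x : ∀ {x y} → x < y → 0# < y - x
  x<y⇒0<y-x {x} {y} x<y = begin-strict
    0#    ≈⟨ -‿inverseʳ x ⟨
    x - x <⟨ +-mono-< (- x) x<y ⟩
    y - x ∎

  +-nonneg : ∀ {x y} → 0# ≤ x → 0# ≤ y → 0# ≤ x + y
  +-nonneg {x} {y} 0≤x 0≤y = begin
    0#      ≈⟨ +-identityˡ 0# ⟨
    0# + 0# ≤⟨ +-mono-≤ 0≤x 0≤y ⟩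
    x + y   ∎

  x≤x+y : ∀ x {y} → 0# ≤ y → x ≤ x + y
  x≤x+y x {y} 0≤y = begin
    x      ≈⟨ +-identityʳ x ⟨
    x + 0# ≤⟨ +-mono-≤ ≤-refl 0≤y ⟩
    x + y  ∎

  x≤y+x : ∀ x {y} → 0# ≤ y → x ≤ y + x
  x≤y+x x {y} 0≤y = ≤-trans (x≤x+y x 0≤y) (≤-reflexive (+-comm x y))

  *-nonneg : ∀ {x y} → 0# ≤ x → 0# ≤ y → 0# ≤ x * y
  *-nonneg         (inj₁ 0<x) (inj₁ 0<y) = inj₁ (*-pos 0<x 0<y)
  *-nonneg {x} {y} (inj₂ 0≈x) _          = inj₂ (trans (sym (zeroˡ y)) (*-congʳ 0≈x))
  *-nonneg {x} {y} (inj₁ _)   (inj₂ 0≈y) = inj₂ (trans (sym (zeroʳ x)) (*-congˡ 0≈y))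

  *-monoˡ-≤ : ∀ {x y z} → 0# ≤ z → x ≤ y → x * z ≤ y * z
  *-monoˡ-≤ {x} {y} {z} 0≤z x≤y = 0≤y-x⇒x≤y (begin
    0#            ≤⟨ *-nonneg (x≤y⇒0≤y-x x≤y) 0≤z ⟩
    (y - x) * z   ≈⟨ solve 3 (λ x y z → (y :- x) :* z := y :* z :- x :* z) refl x y z ⟩
    y * z - x * z ∎)

  square-nonneg : ∀ x → 0# ≤ x * x
  square-nonneg x with ≤-total 0# x
  ... | inj₁ 0≤x = *-nonneg 0≤x 0≤x
  ... | inj₂ x≤0 = begin
    0#                    ≤⟨ *-nonneg (x≤y⇒0≤y-x x≤0) (x≤y⇒0≤y-x x≤0) ⟩
    (0# - x) * (0# - x)   ≈⟨ solve 1 (λ x → (con (0 , 0) :- x) :* (con (0 , 0) :- x) := x :* x) refl x ⟩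
    x * x                 ∎

  square-pos : ∀ {x} → x ≉ 0# → 0# < x * x
  square-pos {x} x≉0 with square-nonneg x
  ... | inj₁ 0<x² = 0<x²
  ... | inj₂ 0≈x² with inverse x≉0
  ...   | y , xy≈1 = contradiction 0<1 (<-irrefl (begin-equality
    0#               ≈⟨ zeroˡ (y * y) ⟨
    0# * (y * y)     ≈⟨ *-congʳ 0≈x² ⟩
    x * x * (y * y)  ≈⟨ solve 2 (λ x y → x :* x :* (y :* y) := x :* y :* (x :* y)) refl x y ⟩
    x * y * (x * y)  ≈⟨ *-cong xy≈1 xy≈1 ⟩
    1# * 1#          ≈⟨ *-identityˡ 1# ⟩
    1#               ∎))

  square+nonneg≈0⇒≈0 : ∀ {x y} → x * x + y ≈ 0# → 0# ≤ y → x ≈ 0#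
  square+nonneg≈0⇒≈0 {x} {y} x²+y≈0 0≤y with compare x 0#
  ... | tri≈ _ x≈0 _ = x≈0
  ... | tri< _ x≉0 _ = contradiction (≤-trans (x≤x+y (x * x) 0≤y) (≤-reflexive x²+y≈0)) (<⇒≱ (square-pos x≉0))
  ... | tri> _ x≉0 _ = contradiction (≤-trans (x≤x+y (x * x) 0≤y) (≤-reflexive x²+y≈0)) (<⇒≱ (square-pos x≉0))

  reciprocal : ∀ {x} → 0# < x → ∃ λ y → 0# < y × x * y ≈ 1#
  reciprocal {x} 0<x with inverse (λ x≈0 → <-irrefl (sym x≈0) 0<x)
  ... | y , xy≈1 with 0# <? y
  ...   | yes 0<y = y , 0<y , xy≈1
  ...   | no  0≮y = contradiction 0<1 (λ 0<1 → <⇒≱ 0<1 (begin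
    1#     ≈⟨ xy≈1 ⟨
    x * y  ≈⟨ *-comm x y ⟩
    y * x  ≤⟨ *-monoˡ-≤ (inj₁ 0<x) (≮⇒≥ 0≮y) ⟩
    0# * x ≈⟨ zeroˡ x ⟩
    0#     ∎))

  private
    0<2 : 0# < 1# + 1#
    0<2 = begin-strict
      0#      <⟨ 0<1 ⟩
      1#      ≤⟨ x≤x+y 1# (inj₁ 0<1) ⟩
      1# + 1# ∎

  ½ : Carrier
  ½ = proj₁ (reciprocal 0<2)

  0<½ : 0# < ½
  0<½ = proj₁ (proj₂ (reciprocal 0<2))

  ½+½≈1 : ½ + ½ ≈ 1#
  ½+½≈1 = begin-equality
    ½ + ½          ≈⟨ solve 1 (λ h → h :+ h := (con (1 , 0) :+ con (1 , 0)) :* h) refl ½ ⟩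
    (1# + 1#) * ½  ≈⟨ proj₂ (proj₂ (reciprocal 0<2)) ⟩
    1#             ∎

  between : ∀ {x y} → x < y → ∃ λ z → x < z × z < y
  between {x} {y} x<y = x + d , x<x+d , x+d<y
    where
    d = (y - x) * ½

    0<d : 0# < d
    0<d = *-pos (x<y⇒0<y-x x<y) 0<½

    x<x+d : x < x + d
    x<x+d = begin-strict
      x       ≈⟨ +-identityˡ x ⟨
      0# + x  <⟨ +-mono-< x 0<d ⟩
      d + x   ≈⟨ +-comm d x ⟩
      x + d   ∎

    x+d<y : x + d < y
    x+d<y = begin-strict
      x + d                  ≈⟨ +-identityˡ _ ⟨
      0# + (x + d)           <⟨ +-mono-< (x + d) 0<d ⟩
      d + (x + d)            ≈⟨ solve 3 (λ x y h →
                                  (y :- x) :* h :+ (x :+ (y :- x) :* h) := x :+ (y :- x) :* (h :+ h))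
                                  refl x y ½ ⟩
      x + (y - x) * (½ + ½)  ≈⟨ +-congˡ (*-congˡ ½+½≈1) ⟩
      x + (y - x) * 1#       ≈⟨ solve 2 (λ x y → x :+ (y :- x) :* con (1 , 0) := y) refl x y ⟩
      y                      ∎

  -- The last component carries strict bounds over to the minimum; it yields positivity of the cell
  -- width and strictness of the new acceptance bound.
  lesser : ∀ x y → ∃ λ z → z ≤ x × z ≤ y × (∀ {u} → u < x → u < y → u < z)
  lesser x y with ≤-total x y
  ... | inj₁ x≤y = x , ≤-refl , x≤y , λ u<x _ → u<x
  ... | inj₂ y≤x = y , y≤x , ≤-refl , λ _ u<y → u<y

  -- Taken as the supremum of the lower bounds, which any element of `S` bounds from above.
  infimum : ∀ S → ∃ S → ∃ (IsLowerBound S) → ∃ (IsInfimum S)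
  infimum S (x , Sx) lower with complete (IsLowerBound S) lower (x , λ b-lower → b-lower Sx)
  ... | s , s-upper , s-least =
    s , (λ Sy → s-least (λ b-lower → b-lower Sy)) , λ {b} b-lower → s-upper {b} b-lower

  -- If no element exceeded `x`, then `x` would be an upper bound below the least one. Leastness
  -- exhibits no element, so this is where the double negations originate.
  <-supremum : ∀ {S s x} → IsSupremum S s → x < s → ¬ ¬ ∃ λ y → S y × x < y
  <-supremum (_ , least) x<s none = <⇒≱ x<s (least (λ {y} Sy → ≮⇒≥ λ x<y → none (y , Sy , x<y)))

  -- Otherwise the multiples are bounded by `y` and have a supremum `s`; some multiple exceeds
  -- `s - x`, and the next one exceeds `s`.
  archimedean : ∀ {x} y → 0# < x → ¬ ¬ ∃ λ n → y ≤ n · x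
  archimedean {x} y 0<x none = <-supremum s-sup s-x<s absurd
    where
    multiples : Pred Carrier 0ℓ
    multiples z = ∃ λ n → z ≈ n · x

    bounded : IsUpperBound multiples y
    bounded (n , z≈nx) = ≮⇒≥ λ y<z → none (n , ≤-trans (inj₁ y<z) (≤-reflexive z≈nx))

    supremum : ∃ (IsSupremum multiples)
    supremum = complete multiples (0# , 0 , refl) (y , bounded)

    s = proj₁ supremum
    s-sup = proj₂ supremum

    s-x<s : s - x < s
    s-x<s = begin-strict
      s - x       ≈⟨ +-identityˡ _ ⟨
      0# + (s - x) <⟨ +-mono-< (s - x) 0<x ⟩
      x + (s - x) ≈⟨ solve 2 (λ x s → x :+ (s :- x) := s) refl x s ⟩
      s           ∎

    absurd : ¬ ∃ λ z → multiples z × s - x < z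
    absurd (z , (n , z≈nx) , s-x<z) = <⇒≱ (begin-strict
      s             ≈⟨ solve 2 (λ x s → s := (s :- x) :+ x) refl x s ⟩
      (s - x) + x   <⟨ +-mono-< x s-x<z ⟩
      z + x         ≈⟨ +-comm z x ⟩
      x + z         ≈⟨ +-congˡ z≈nx ⟩
      x + n · x     ∎) (proj₁ s-sup (suc n , refl))

  -- The index of the cell of width w containing x, counted from a; the last cell is unbounded.
  cell : (a w : Carrier) (n : ℕ) → Carrier → Fin (suc n)
  cell a w zero    x = zero
  cell a w (suc n) x with x <? a + w
  ... | yes _ = zero
  ... | no  _ = suc (cell (a + w) w n x)

  -- In a bounded cell `y` lies below the right end and `x` above the left end; in the last cell the
  -- bound on `y` supplies the right end. The conclusion is one-sided: exchanging `x` and `y` gives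
  -- the other half.
  same-cell : ∀ a w n {x y} → 0# ≤ w → a ≤ x → y ≤ a + suc n · w → cell a w n x ≡ cell a w n y → y ≤ x + w
  same-cell a w zero {x} {y} 0≤w a≤x y≤ _ = begin
    y            ≤⟨ y≤ ⟩
    a + (w + 0#) ≈⟨ +-congˡ (+-identityʳ w) ⟩
    a + w        ≤⟨ +-monoˡ-≤ w a≤x ⟩
    x + w        ∎
  same-cell a w (suc n) {x} {y} 0≤w a≤x y≤ same with x <? a + w | y <? a + w
  ... | yes _ | yes y<a+w = ≤-trans (inj₁ y<a+w) (+-monoˡ-≤ w a≤x)
  ... | no x≮a+w | no _ =
    same-cell (a + w) w n 0≤w (≮⇒≥ x≮a+w)
      (≤-trans y≤ (≤-reflexive (sym (+-assoc a w _)))) (suc-injective same)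
  same-cell a w (suc n) 0≤w a≤x y≤ () | yes _ | no _
  same-cell a w (suc n) 0≤w a≤x y≤ () | no _ | yes _

  -- The difference `w * w - (x - y) * (x - y)` factors into two terms that the hypotheses make
  -- nonnegative.
  close⇒square≤ : ∀ {x y w} → x ≤ y + w → y ≤ x + w → (x - y) * (x - y) ≤ w * w
  close⇒square≤ {x} {y} {w} x≤y+w y≤x+w = 0≤y-x⇒x≤y (begin
    0# ≤⟨ *-nonneg (x≤y⇒0≤y-x x≤y+w) (x≤y⇒0≤y-x y≤x+w) ⟩
    ((y + w) - x) * ((x + w) - y)
      ≈⟨ solve 3 (λ x y w → ((y :+ w) :- x) :* ((x :+ w) :- y) := w :* w :- (x :- y) :* (x :- y)) refl x y w ⟩
    w * w - (x - y) * (x - y) ∎)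

  -- Here `b + 1#` stands in for the square root of `b`, since its square exceeds `b`.
  square≤⇒≤ : ∀ {x b} → 0# ≤ b → x * x ≤ b → x ≤ b + 1#
  square≤⇒≤ {x} {b} 0≤b x²≤b = ≮⇒≥ λ b+1<x → <⇒≱ (begin-strict
    b              ≈⟨ +-identityˡ b ⟨
    0# + b         <⟨ +-mono-< b 0<1 ⟩
    1# + b         ≈⟨ +-comm 1# b ⟩
    b + 1#         ≈⟨ *-identityˡ _ ⟨
    1# * (b + 1#)  ≤⟨ *-monoˡ-≤ (+-nonneg 0≤b (inj₁ 0<1)) (x≤y+x 1# 0≤b) ⟩
    (b + 1#) * (b + 1#) ≤⟨ *-monoˡ-≤ (+-nonneg 0≤b (inj₁ 0<1)) (inj₁ b+1<x) ⟩
    x * (b + 1#)   ≈⟨ *-comm x _ ⟩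
    (b + 1#) * x   ≤⟨ *-monoˡ-≤ (≤-trans (+-nonneg 0≤b (inj₁ 0<1)) (inj₁ b+1<x)) (inj₁ b+1<x) ⟩
    x * x          ∎) x²≤b

  square≤⇒-≤ : ∀ {x b} → 0# ≤ b → x * x ≤ b → - (b + 1#) ≤ x
  square≤⇒-≤ {x} {b} 0≤b x²≤b = 0≤y-x⇒x≤y (begin
    0#                ≤⟨ x≤y⇒0≤y-x (square≤⇒≤ 0≤b (≤-trans (≤-reflexive -x*-x≈x*x) x²≤b)) ⟩
    (b + 1#) - (- x)  ≈⟨ solve 2 (λ x c → c :- (:- x) := x :- (:- c)) refl x (b + 1#) ⟩
    x - (- (b + 1#))  ∎)
    where
    -x*-x≈x*x : - x * - x ≈ x * x
    -x*-x≈x*x = solve 1 (λ x → (:- x) :* (:- x) := x :* x) refl x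

  -- The numbers in question lie between `- (b + 1#)` and `b + 1#`, an interval cut into cells of
  -- width `w`. Taking `w` as the lesser of `ε` and 1 gives `w * w ≤ w ≤ ε` without a root of `ε`.
  bounded-colouring : ∀ {ε} b → 0# ≤ b → 0# < ε → ¬ ¬ ∃ λ n → Σ (Carrier → Fin n) λ colour →
    ∀ x y → x * x ≤ b → y * y ≤ b → colour x ≡ colour y → (x - y) * (x - y) ≤ ε
  bounded-colouring {ε} b 0≤b 0<ε none with lesser ε 1#
  ... | w , w≤ε , w≤1 , min = archimedean ((b + 1#) + (b + 1#)) 0<w λ (n , 2b+2≤nw) →
    none (suc n , cell (- (b + 1#)) w n , λ x y x²≤b y²≤b same → begin
      (x - y) * (x - y) ≤⟨ close⇒square≤
                             (side n 2b+2≤nw y²≤b x²≤b (≡.sym same))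
                             (side n 2b+2≤nw x²≤b y²≤b same) ⟩
      w * w             ≤⟨ *-monoˡ-≤ (inj₁ 0<w) w≤1 ⟩
      1# * w            ≈⟨ *-identityˡ w ⟩
      w                 ≤⟨ w≤ε ⟩
      ε                 ∎)
    where
    0<w : 0# < w
    0<w = min 0<ε 0<1

    side : ∀ n → (b + 1#) + (b + 1#) ≤ n · w → ∀ {x y} → x * x ≤ b → y * y ≤ b →
           cell (- (b + 1#)) w n x ≡ cell (- (b + 1#)) w n y → y ≤ x + w
    side n 2b+2≤nw {x} {y} x²≤b y²≤b = same-cell _ w n (inj₁ 0<w) (square≤⇒-≤ 0≤b x²≤b) (begin
      y                                        ≤⟨ square≤⇒≤ 0≤b y²≤b ⟩
      b + 1#                                   ≈⟨ solve 1 (λ c → c := :- c :+ (c :+ c)) refl (b + 1#) ⟩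
      - (b + 1#) + ((b + 1#) + (b + 1#))       ≤⟨ +-mono-≤ ≤-refl (≤-trans 2b+2≤nw (x≤y+x _ (inj₁ 0<w))) ⟩
      - (b + 1#) + suc n · w                   ∎)

-- Conjugation and modulus of complex numbers

module ComplexProperties (ℝ : CompleteOrderedField) where
  open CompleteOrderedField ℝ hiding (zero)
  open OrderedField ℝ
  open Complex ℝ
  private
    module ℂ-Ring = CommutativeRing ℂ-commutativeRing
    module RS = IntegerCoefficients commutativeRing

  open _≈ℂ_ public

  ∣∣²-cong : ∀ {z w} → z ≈ℂ w → ∣ z ∣² ≈ ∣ w ∣²
  ∣∣²-cong (a , b) = +-cong (*-cong a a) (*-cong b b)

  ∣∣²-nonneg : ∀ z → 0# ≤ ∣ z ∣²
  ∣∣²-nonneg (a +i b) = +-nonneg (square-nonneg a) (square-nonneg b)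

  conj-cong : ∀ {z w} → z ≈ℂ w → conj z ≈ℂ conj w
  conj-cong (p , q) = p , -‿cong q

  conj-+ : ∀ z w → conj (z +ℂ w) ≈ℂ conj z +ℂ conj w
  conj-+ (a +i b) (c +i d) = refl , RS.solve 2 (λ b d → :- (b :+ d) := (:- b) :+ (:- d)) refl b d
    where open RS using (_:+_; :-_; _:=_)

  conj-conj-* : ∀ z w → conj w *ℂ z ≈ℂ conj (conj z *ℂ w)
  conj-conj-* (a +i b) (c +i d) =
    RS.solve 4 (λ a b c d → c :* a :- (:- d) :* b := a :* c :- (:- b) :* d) refl a b c d ,
    RS.solve 4 (λ a b c d → c :* b :+ (:- d) :* a := :- (a :* d :+ (:- b) :* c)) refl a b c d
    where open RS using (_:+_; _:*_; _:-_; :-_; _:=_)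

  re-conj-* : ∀ z → re (conj z *ℂ z) ≈ ∣ z ∣²
  re-conj-* (a +i b) = RS.solve 2 (λ a b → a :* a :- (:- b) :* b := a :* a :+ b :* b) refl a b
    where open RS using (_:+_; _:*_; _:-_; :-_; _:=_)

  -- The slack `y` holds the other terms of a vanishing sum of squares, such as the second
  -- coordinate of a vector in the plane.
  ∣∣²-definite : ∀ z {y} → ∣ z ∣² + y ≈ 0# → 0# ≤ y → z ≈ℂ 0ℂ
  ∣∣²-definite (a +i b) {y} sum≈0 0≤y =
    square+nonneg≈0⇒≈0 (trans (sym (+-assoc _ _ _)) sum≈0) (+-nonneg (square-nonneg b) 0≤y) ,
    square+nonneg≈0⇒≈0 (trans (trans (sym (+-assoc _ _ _)) (+-congʳ (+-comm _ _))) sum≈0)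
      (+-nonneg (square-nonneg a) 0≤y)

  conj-0-* : ∀ {z} w → z ≈ℂ 0ℂ → conj z *ℂ w ≈ℂ 0ℂ
  conj-0-* (c +i d) z≈0 = ℂ-Ring.trans (ℂ-Ring.*-congʳ (conj-cong z≈0))
    ( RS.solve 2 (λ c d → 𝟘 :* c :- (:- 𝟘) :* d := 𝟘) refl c d
    , RS.solve 2 (λ c d → 𝟘 :* d :+ (:- 𝟘) :* c := 𝟘) refl c d)
    where
    open RS using (_:+_; _:*_; _:-_; :-_; _:=_)
    𝟘 : RS.Polynomial 2
    𝟘 = RS.con (0 , 0)

-- Hilbert space geometry: squared norms and orthogonal projection

module HilbertSpace (ℝ : CompleteOrderedField) (H : Quantum.FiniteDimensionalHilbertSpace ℝ) where
  open CompleteOrderedField ℝ hiding (zero)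
  open OrderedField ℝ
  open Quantum ℝ
  open FiniteDimensionalHilbertSpace H
  open ComplexProperties ℝ

  private
    module ℂ-Ring = CommutativeRing ℂ-commutativeRing
    module RS = IntegerCoefficients commutativeRing
    module CS = IntegerCoefficients ℂ-commutativeRing
    module ℂ-Reasoning = SetoidReasoning ℂ-Ring.setoid
    module Vector-Reasoning = SetoidReasoning ≈ᴹ-setoid
    open CommutativeSemigroupProperties (CommutativeMonoid.commutativeSemigroup +ᴹ-commutativeMonoid)
      using (interchange)

  linearʳ : ∀ x r y z → ⟨ x ∣ r *ₗ y +ᴹ z ⟩ ≈ℂ r *ℂ ⟨ x ∣ y ⟩ +ℂ ⟨ x ∣ z ⟩
  linearʳ x r y z = ℂ-Ring.trans (⟨∣⟩-+ x (r *ₗ y) z) (ℂ-Ring.+-congʳ (⟨∣⟩-* x r y))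

  conjugate-linearˡ : ∀ x r y z → ⟨ r *ₗ y +ᴹ z ∣ x ⟩ ≈ℂ conj (r *ℂ ⟨ x ∣ y ⟩ +ℂ ⟨ x ∣ z ⟩)
  conjugate-linearˡ x r y z = ℂ-Ring.trans (⟨∣⟩-conj x _) (conj-cong (linearʳ x r y z))

  norm² : Vector → Carrier
  norm² x = re ⟨ x ∣ x ⟩

  norm²-cong : ∀ {x y} → x ≈ᴹ y → norm² x ≈ norm² y
  norm²-cong x≈y = re≈ (⟨∣⟩-cong x≈y x≈y)

  unit⇒norm²≈1 : ∀ {x} → IsUnit x → norm² x ≈ 1#
  unit⇒norm²≈1 = re≈

  -- Conjugate symmetry equates the imaginary part with its own negative; halving then makes it
  -- vanish.
  ⟨x∣x⟩≈norm² : ∀ x → ⟨ x ∣ x ⟩ ≈ℂ norm² x +i 0#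
  ⟨x∣x⟩≈norm² x = refl , (begin-equality
    b            ≈⟨ *-identityˡ b ⟨
    1# * b       ≈⟨ *-congʳ ½+½≈1 ⟨
    (½ + ½) * b  ≈⟨ RS.solve 2 (λ h b → (h RS.:+ h) RS.:* b RS.:= h RS.:* (b RS.:+ b)) refl ½ b ⟩
    ½ * (b + b)  ≈⟨ *-congˡ (+-congˡ (im≈ (⟨∣⟩-conj x x))) ⟩
    ½ * (b - b)  ≈⟨ *-congˡ (-‿inverseʳ b) ⟩
    ½ * 0#       ≈⟨ zeroʳ ½ ⟩
    0#           ∎)
    where
    open ≤-Reasoning
    b = im ⟨ x ∣ x ⟩

  norm²-expand : ∀ r y x →
    norm² (r *ₗ y +ᴹ x) ≈ ∣ r ∣² * norm² y + (re (r *ℂ ⟨ x ∣ y ⟩) + re (r *ℂ ⟨ x ∣ y ⟩)) + norm² x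
  norm²-expand r@(r₁ +i r₂) y x = begin-equality
    norm² z
      ≈⟨ re≈ expand ⟩
    re (r *ℂ conj (r *ℂ ⟨ y ∣ y ⟩ +ℂ conj ⟨ x ∣ y ⟩) +ℂ conj (r *ℂ ⟨ x ∣ y ⟩ +ℂ ⟨ x ∣ x ⟩))
      ≈⟨ RS.solve 7 (λ r₁ r₂ Y₁ Y₂ Z₁ Z₂ X₁ →
           (r₁ :* ((r₁ :* Y₁ :- r₂ :* Y₂) :+ Z₁) :- r₂ :* (:- ((r₁ :* Y₂ :+ r₂ :* Y₁) :+ (:- Z₂))))
             :+ ((r₁ :* Z₁ :- r₂ :* Z₂) :+ X₁) :=
           (r₁ :* r₁ :+ r₂ :* r₂) :* Y₁ :+ ((r₁ :* Z₁ :- r₂ :* Z₂) :+ (r₁ :* Z₁ :- r₂ :* Z₂)) :+ X₁)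
         refl r₁ r₂ (re ⟨ y ∣ y ⟩) (im ⟨ y ∣ y ⟩) (re ⟨ x ∣ y ⟩) (im ⟨ x ∣ y ⟩) (re ⟨ x ∣ x ⟩) ⟩
    ∣ r ∣² * norm² y + (re (r *ℂ ⟨ x ∣ y ⟩) + re (r *ℂ ⟨ x ∣ y ⟩)) + norm² x ∎
    where
    open ≤-Reasoning
    open RS using (_:*_; _:+_; _:-_; :-_; _:=_)
    z = r *ₗ y +ᴹ x

    expand : ⟨ z ∣ z ⟩ ≈ℂ r *ℂ conj (r *ℂ ⟨ y ∣ y ⟩ +ℂ conj ⟨ x ∣ y ⟩) +ℂ conj (r *ℂ ⟨ x ∣ y ⟩ +ℂ ⟨ x ∣ x ⟩)
    expand = ℂ-Ring.trans (linearʳ z r y x) (ℂ-Ring.+-cong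
      (ℂ-Ring.*-congˡ (ℂ-Ring.trans (conjugate-linearˡ y r y x)
        (conj-cong (ℂ-Ring.+-congˡ (⟨∣⟩-conj x y)))))
      (conjugate-linearˡ x r y x))

  pythagoras : ∀ r {y x} → ⟨ y ∣ x ⟩ ≈ℂ 0ℂ → norm² (r *ₗ y +ᴹ x) ≈ ∣ r ∣² * norm² y + norm² x
  pythagoras r {y} {x} y⊥x = begin-equality
    norm² (r *ₗ y +ᴹ x)
      ≈⟨ norm²-expand r y x ⟩
    ∣ r ∣² * norm² y + (re (r *ℂ ⟨ x ∣ y ⟩) + re (r *ℂ ⟨ x ∣ y ⟩)) + norm² x
      ≈⟨ +-congʳ (+-congˡ (+-cong vanish vanish)) ⟩
    ∣ r ∣² * norm² y + (0# + 0#) + norm² x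
      ≈⟨ RS.solve 2 (λ a b → a RS.:+ (RS.con (0 , 0) RS.:+ RS.con (0 , 0)) RS.:+ b RS.:= a RS.:+ b) refl _ _ ⟩
    ∣ r ∣² * norm² y + norm² x ∎
    where
    open ≤-Reasoning
    x⊥y : ⟨ x ∣ y ⟩ ≈ℂ conj 0ℂ
    x⊥y = ℂ-Ring.trans (⟨∣⟩-conj y x) (conj-cong y⊥x)

    vanish : re (r *ℂ ⟨ x ∣ y ⟩) ≈ 0#
    vanish = trans (re≈ (ℂ-Ring.*-congˡ {x = r} x⊥y))
      (RS.solve 2 (λ a b → a RS.:* RS.con (0 , 0) RS.:- b RS.:* (RS.:- RS.con (0 , 0)) RS.:= RS.con (0 , 0))
        refl (re r) (im r))

  -- Subtraction is put in the shape `r *ₗ y +ᴹ x`, so that every expansion and linearity law stated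
  -- for that shape covers it with `r` equal to minus one.
  _⊖_ : Vector → Vector → Vector
  x ⊖ y = (-ℂ 1ℂ) *ₗ y +ᴹ x

  ⊖-self : ∀ x → x ⊖ x ≈ᴹ 0ᴹ
  ⊖-self x = begin
    (-ℂ 1ℂ) *ₗ x +ᴹ x        ≈⟨ +ᴹ-congˡ (*ₗ-identityˡ x) ⟨
    (-ℂ 1ℂ) *ₗ x +ᴹ 1ℂ *ₗ x  ≈⟨ *ₗ-distribʳ x _ _ ⟨
    (-ℂ 1ℂ +ℂ 1ℂ) *ₗ x       ≈⟨ *ₗ-congʳ (ℂ-Ring.-‿inverseˡ 1ℂ) ⟩
    0ℂ *ₗ x                  ≈⟨ *ₗ-zeroˡ x ⟩
    0ᴹ                       ∎
    where open Vector-Reasoning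

  absorb : ∀ r {y} x → y ≈ᴹ 0ᴹ → r *ₗ y +ᴹ x ≈ᴹ x
  absorb r {y} x y≈0 = begin
    r *ₗ y +ᴹ x  ≈⟨ +ᴹ-congʳ (*ₗ-congˡ y≈0) ⟩
    r *ₗ 0ᴹ +ᴹ x ≈⟨ +ᴹ-congʳ (*ₗ-zeroʳ r) ⟩
    0ᴹ +ᴹ x      ≈⟨ +ᴹ-identityˡ x ⟩
    x            ∎
    where open Vector-Reasoning

  -- Translates the distance controlled by a colouring into the overlap wanted in `recurrence`.
  norm²-difference : ∀ {x y} → IsUnit x → IsUnit y → norm² (x ⊖ y) ≈ (1# - re ⟨ x ∣ y ⟩) + (1# - re ⟨ x ∣ y ⟩)
  norm²-difference {x} {y} x-unit y-unit = begin-equality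
    norm² (x ⊖ y)
      ≈⟨ norm²-expand (-ℂ 1ℂ) y x ⟩
    ∣ -ℂ 1ℂ ∣² * norm² y + (re (-ℂ 1ℂ *ℂ ⟨ x ∣ y ⟩) + re (-ℂ 1ℂ *ℂ ⟨ x ∣ y ⟩)) + norm² x
      ≈⟨ +-cong (+-congʳ (*-congˡ (unit⇒norm²≈1 y-unit))) (unit⇒norm²≈1 x-unit) ⟩
    ∣ -ℂ 1ℂ ∣² * 1# + (re (-ℂ 1ℂ *ℂ ⟨ x ∣ y ⟩) + re (-ℂ 1ℂ *ℂ ⟨ x ∣ y ⟩)) + 1#
      ≈⟨ RS.solve 2 (λ a b →
           ((:- 𝟙) :* (:- 𝟙) :+ (:- 𝟘) :* (:- 𝟘)) :* 𝟙
             :+ (((:- 𝟙) :* a :- (:- 𝟘) :* b) :+ ((:- 𝟙) :* a :- (:- 𝟘) :* b)) :+ 𝟙 :=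
           (𝟙 :- a) :+ (𝟙 :- a))
         refl (re ⟨ x ∣ y ⟩) (im ⟨ x ∣ y ⟩) ⟩
    (1# - re ⟨ x ∣ y ⟩) + (1# - re ⟨ x ∣ y ⟩) ∎
    where
    open ≤-Reasoning
    open RS using (_:*_; _:+_; _:-_; :-_; _:=_; con)
    𝟘 𝟙 : ∀ {n} → RS.Polynomial n
    𝟘 = con (0 , 0)
    𝟙 = con (1 , 0)

  -- Orthogonal projection onto the line of `e`, which is not normalised: `q` is the reciprocal of
  -- its squared norm.
  module Projection (e : Vector) (q : Carrier) (norm²e*q≈1 : norm² e * q ≈ 1#) where
    coefficient : Vector → ℂ
    coefficient x = (q +i 0#) *ℂ ⟨ e ∣ x ⟩

    remainder : Vector → Vector
    remainder x = (-ℂ coefficient x) *ₗ e +ᴹ x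

    coefficient-cong : ∀ {x y} → x ≈ᴹ y → coefficient x ≈ℂ coefficient y
    coefficient-cong x≈y = ℂ-Ring.*-congˡ (⟨∣⟩-cong ≈ᴹ-refl x≈y)

    remainder-cong : ∀ {x y} → x ≈ᴹ y → remainder x ≈ᴹ remainder y
    remainder-cong x≈y = +ᴹ-cong (*ₗ-cong (ℂ-Ring.-‿cong (coefficient-cong x≈y)) ≈ᴹ-refl) x≈y

    coefficient-linear : ∀ r y x → coefficient (r *ₗ y +ᴹ x) ≈ℂ r *ℂ coefficient y +ℂ coefficient x
    coefficient-linear r y x = ℂ-Ring.trans (ℂ-Ring.*-congˡ (linearʳ e r y x))
      (CS.solve 4 (λ r q y x → q CS.:* (r CS.:* y CS.:+ x) CS.:= r CS.:* (q CS.:* y) CS.:+ q CS.:* x)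
        ℂ-Ring.refl r (q +i 0#) ⟨ e ∣ y ⟩ ⟨ e ∣ x ⟩)

    remainder-linear : ∀ r y x → remainder (r *ₗ y +ᴹ x) ≈ᴹ r *ₗ remainder y +ᴹ remainder x
    remainder-linear r y x = begin
      (-ℂ coefficient (r *ₗ y +ᴹ x)) *ₗ e +ᴹ (r *ₗ y +ᴹ x)
        ≈⟨ +ᴹ-congʳ (*ₗ-congʳ (ℂ-Ring.trans (ℂ-Ring.-‿cong (coefficient-linear r y x))
             (CS.solve 3 (λ r a b → CS.:- (r CS.:* a CS.:+ b) CS.:= r CS.:* (CS.:- a) CS.:+ (CS.:- b))
               ℂ-Ring.refl r (coefficient y) (coefficient x)))) ⟩
      (r *ℂ (-ℂ coefficient y) +ℂ (-ℂ coefficient x)) *ₗ e +ᴹ (r *ₗ y +ᴹ x)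
        ≈⟨ +ᴹ-congʳ (*ₗ-distribʳ e _ _) ⟩
      ((r *ℂ (-ℂ coefficient y)) *ₗ e +ᴹ (-ℂ coefficient x) *ₗ e) +ᴹ (r *ₗ y +ᴹ x)
        ≈⟨ interchange _ _ _ _ ⟩
      ((r *ℂ (-ℂ coefficient y)) *ₗ e +ᴹ r *ₗ y) +ᴹ remainder x
        ≈⟨ +ᴹ-congʳ (+ᴹ-congʳ (*ₗ-assoc r _ e)) ⟩
      (r *ₗ ((-ℂ coefficient y) *ₗ e) +ᴹ r *ₗ y) +ᴹ remainder x
        ≈⟨ +ᴹ-congʳ (*ₗ-distribˡ r _ _) ⟨
      r *ₗ remainder y +ᴹ remainder x ∎
      where open Vector-Reasoning

    q⟨e∣e⟩≈1 : coefficient e ≈ℂ 1ℂ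
    q⟨e∣e⟩≈1 = ℂ-Ring.trans (ℂ-Ring.*-congˡ (⟨x∣x⟩≈norm² e))
      ( trans (RS.solve 2 (λ q n → q :* n :- 𝟘 :* 𝟘 := n :* q) refl q (norm² e)) norm²e*q≈1
      , RS.solve 2 (λ q n → q :* 𝟘 :+ 𝟘 :* n := 𝟘) refl q (norm² e))
      where
      open RS using (_:*_; _:+_; _:-_; _:=_)
      𝟘 : RS.Polynomial 2
      𝟘 = RS.con (0 , 0)

    remainder-e : remainder e ≈ᴹ 0ᴹ
    remainder-e = ≈ᴹ-trans (+ᴹ-congʳ (*ₗ-congʳ (ℂ-Ring.-‿cong q⟨e∣e⟩≈1))) (⊖-self e)

    decomposition : ∀ x → coefficient x *ₗ e +ᴹ remainder x ≈ᴹ x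
    decomposition x = begin
      c *ₗ e +ᴹ ((-ℂ c) *ₗ e +ᴹ x)  ≈⟨ +ᴹ-assoc _ _ _ ⟨
      (c *ₗ e +ᴹ (-ℂ c) *ₗ e) +ᴹ x  ≈⟨ +ᴹ-congʳ (*ₗ-distribʳ e _ _) ⟨
      (c +ℂ (-ℂ c)) *ₗ e +ᴹ x       ≈⟨ +ᴹ-congʳ (*ₗ-congʳ (ℂ-Ring.-‿inverseʳ c)) ⟩
      0ℂ *ₗ e +ᴹ x                  ≈⟨ +ᴹ-congʳ (*ₗ-zeroˡ e) ⟩
      0ᴹ +ᴹ x                       ≈⟨ +ᴹ-identityˡ x ⟩
      x                             ∎
      where
      open Vector-Reasoning
      c = coefficient x

    e⊥remainder : ∀ x → ⟨ e ∣ remainder x ⟩ ≈ℂ 0ℂ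
    e⊥remainder x = begin
      ⟨ e ∣ remainder x ⟩
        ≈⟨ linearʳ e _ e x ⟩
      (-ℂ (Q *ℂ ⟨ e ∣ x ⟩)) *ℂ ⟨ e ∣ e ⟩ +ℂ ⟨ e ∣ x ⟩
        ≈⟨ CS.solve 3 (λ q s t → (:- (q :* s)) :* t :+ s := (CS.con (1 , 0) :- q :* t) :* s)
             ℂ-Ring.refl Q ⟨ e ∣ x ⟩ ⟨ e ∣ e ⟩ ⟩
      (1ℂ ℂ-Ring.- coefficient e) *ℂ ⟨ e ∣ x ⟩
        ≈⟨ ℂ-Ring.*-congʳ (ℂ-Ring.trans (ℂ-Ring.+-congˡ (ℂ-Ring.-‿cong q⟨e∣e⟩≈1)) (ℂ-Ring.-‿inverseʳ 1ℂ)) ⟩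
      0ℂ *ℂ ⟨ e ∣ x ⟩
        ≈⟨ ℂ-Ring.zeroˡ _ ⟩
      0ℂ ∎
      where
      open ℂ-Reasoning
      open CS using (_:*_; _:+_; _:-_; :-_; _:=_)
      Q = q +i 0#

    norm²-decomposition : ∀ x → norm² x ≈ ∣ coefficient x ∣² * norm² e + norm² (remainder x)
    norm²-decomposition x =
      trans (norm²-cong (≈ᴹ-sym (decomposition x))) (pythagoras (coefficient x) (e⊥remainder x))

  -- Bessel's inequality for one unit vector: with `q` equal to 1 the coefficient of `y` along `x`
  -- is their inner product, and the remainder only adds to the norm.
  cauchy-schwarz : ∀ {x y} → IsUnit x → IsUnit y → ∣ ⟨ x ∣ y ⟩ ∣² ≤ 1#
  cauchy-schwarz {x} {y} x-unit y-unit = begin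
    ∣ ⟨ x ∣ y ⟩ ∣²                                 ≈⟨ ∣∣²-cong (ℂ-Ring.*-identityˡ _) ⟨
    ∣ coefficient y ∣²                             ≈⟨ *-identityʳ _ ⟨
    ∣ coefficient y ∣² * 1#                        ≈⟨ *-congˡ (unit⇒norm²≈1 x-unit) ⟨
    ∣ coefficient y ∣² * norm² x                   ≤⟨ x≤x+y _ (⟨∣⟩-nonneg (remainder y)) ⟩
    ∣ coefficient y ∣² * norm² x + norm² (remainder y) ≈⟨ norm²-decomposition y ⟨
    norm² y                                        ≈⟨ unit⇒norm²≈1 y-unit ⟩
    1#                                             ∎
    where
    open ≤-Reasoning
    open Projection x 1# (trans (*-identityʳ _) (unit⇒norm²≈1 x-unit))

  -- Spans and total boundedness of the unit ball

  -- Recursive, so that an induction can peel off the first vector and replace the remaining ones by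
  -- their projections.
  Span : ∀ {n} → (Fin n → Vector) → Pred Vector 0ℓ
  Span {zero}  b x = x ≈ᴹ 0ᴹ
  Span {suc n} b x = ∃ λ r → ∃ λ y → Span (b ∘ suc) y × x ≈ᴹ r *ₗ b zero +ᴹ y

  Span-resp : ∀ {n} (b : Fin n → Vector) {x y} → x ≈ᴹ y → Span b x → Span b y
  Span-resp {zero}  b x≈y x≈0               = ≈ᴹ-trans (≈ᴹ-sym x≈y) x≈0
  Span-resp {suc n} b x≈y (r , z , Sz , x≈) = r , z , Sz , ≈ᴹ-trans (≈ᴹ-sym x≈y) x≈

  sum∈Span : ∀ {n} (b : Fin n → Vector) (r : Fin n → ℂ) → Span b (sum (λ i → r i *ₗ b i))
  sum∈Span {zero}  b r = ≈ᴹ-refl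
  sum∈Span {suc n} b r = r zero , _ , sum∈Span (b ∘ suc) (r ∘ suc) , ≈ᴹ-refl

  Span-map : ∀ {f : Vector → Vector} → (∀ {x y} → x ≈ᴹ y → f x ≈ᴹ f y) →
             (∀ r y x → f (r *ₗ y +ᴹ x) ≈ᴹ r *ₗ f y +ᴹ f x) →
             ∀ {n} (b : Fin n → Vector) {x} → Span b x → Span (f ∘ b) (f x)
  Span-map {f} f-cong f-linear {zero} b {x} x≈0 = begin
    -- The one linearity law gives `f 0ᴹ ≈ᴹ 0ᴹ` by writing zero as `0ᴹ ⊖ 0ᴹ`.
    f x          ≈⟨ f-cong (≈ᴹ-trans x≈0 (≈ᴹ-sym (⊖-self 0ᴹ))) ⟩
    f (0ᴹ ⊖ 0ᴹ)  ≈⟨ f-linear _ _ _ ⟩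
    f 0ᴹ ⊖ f 0ᴹ  ≈⟨ ⊖-self (f 0ᴹ) ⟩
    0ᴹ           ∎
    where open Vector-Reasoning
  Span-map f-cong f-linear {suc n} b (r , y , Sy , x≈) =
    r , _ , Span-map f-cong f-linear (b ∘ suc) Sy , ≈ᴹ-trans (f-cong x≈) (f-linear r _ y)

  -- A finite cover by small sets, recorded as a function to colours: the pigeonhole principle
  -- applies to it directly, with no centres to choose.
  Colouring : ∀ {n} → (Fin n → Vector) → Carrier → Set
  Colouring b ε = ∃ λ m → Σ (Vector → Fin m) λ colour →
    ∀ x y → Span b x → Span b y → norm² x ≤ 1# → norm² y ≤ 1# →
    colour x ≡ colour y → norm² (x ⊖ y) ≤ ε

  -- Total boundedness of the unit ball: split off the component along the first spanning vector.
  colouring : ∀ {n} (b : Fin n → Vector) {ε} → 0# < ε → ¬ ¬ Colouring b ε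
  colouring {zero} b {ε} 0<ε none = none (1 , (λ _ → zero) , λ x y x≈0 y≈0 _ _ _ → begin
    norm² (x ⊖ y) ≈⟨ norm²-cong (≈ᴹ-trans (absorb _ x y≈0) x≈0) ⟩
    norm² 0ᴹ      ≈⟨ re≈ (⟨∣⟩-cong ≈ᴹ-refl (≈ᴹ-sym (*ₗ-zeroˡ 0ᴹ))) ⟩
    re ⟨ 0ᴹ ∣ 0ℂ *ₗ 0ᴹ ⟩ ≈⟨ re≈ (⟨∣⟩-* 0ᴹ 0ℂ 0ᴹ) ⟩
    re (0ℂ *ℂ ⟨ 0ᴹ ∣ 0ᴹ ⟩) ≈⟨ re≈ (ℂ-Ring.zeroˡ ⟨ 0ᴹ ∣ 0ᴹ ⟩) ⟩
    0#            <⟨ 0<ε ⟩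
    ε             ∎)
    where open ≤-Reasoning
  colouring {suc n} b {ε} 0<ε none with compare (norm² (b zero)) 0#
  ... | tri< e<0 _ _ = <⇒≱ e<0 (⟨∣⟩-nonneg (b zero))
  -- The spanning vectors may be dependent, so the first one can be zero; it is then dropped.
  ... | tri≈ _ e≈0 _ = colouring (b ∘ suc) 0<ε λ (m , colour , close) →
    none (m , colour , λ x y Sx Sy → close x y (drop Sx) (drop Sy))
    where
    drop : ∀ {x} → Span b x → Span (b ∘ suc) x
    drop (r , y , Sy , x≈) =
      Span-resp (b ∘ suc) (≈ᴹ-sym (≈ᴹ-trans x≈ (absorb r y
        (⟨∣⟩-definite (ℂ-Ring.trans (⟨x∣x⟩≈norm² (b zero)) (e≈0 , refl)))))) Sy
  ... | tri> _ _ 0<e with reciprocal 0<e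
  ...   | q , 0<q , eq≈1 =
    -- In the unit ball the squared coefficient times `norm² e` is at most 1, so `q` bounds the
    -- squares of its real and imaginary parts.
    bounded-colouring q (inj₁ 0<q) 0<δ λ (k , cell , cell-close) →
    colouring (remainder ∘ b ∘ suc) 0<ε½ λ (m , colour , close) →
    none (k ℕ.* k ℕ.* m
      , (λ x → combine (combine (cell (re (coefficient x))) (cell (im (coefficient x))))
                 (colour (remainder x)))
      , λ x y Sx Sy x≤1 y≤1 same →
          let same₁₂ , same₃ = combine-injective _ _ _ _ same
              same₁ , same₂ = combine-injective _ _ _ _ same₁₂
          in combined x y
               (cell-close _ _ (re-bounded x≤1) (re-bounded y≤1) same₁)
               (cell-close _ _ (im-bounded x≤1) (im-bounded y≤1) same₂)
               (close _ _ (project Sx) (project Sy) (remainder-bounded x≤1) (remainder-bounded y≤1) same₃))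
    where
    open ≤-Reasoning
    e = b zero
    open Projection e q eq≈1
    -- Chosen so that `(δ + δ) * norm² e`, the share of the real and imaginary parts together, is
    -- half of `ε`; the remainder takes the other half.
    δ = ε * ½ * (½ * q)

    0<ε½ : 0# < ε * ½
    0<ε½ = *-pos 0<ε 0<½

    0<δ : 0# < δ
    0<δ = *-pos 0<ε½ (*-pos 0<½ 0<q)

    -- The vector `e` has remainder zero, so only the projections of the other spanning vectors
    -- survive, one vector fewer.
    project : ∀ {x} → Span b x → Span (remainder ∘ b ∘ suc) (remainder x)
    project {x} (r , y , Sy , x≈) = Span-resp (remainder ∘ b ∘ suc) (≈ᴹ-sym (≈ᴹ-trans (remainder-cong x≈)
      (≈ᴹ-trans (remainder-linear r e y) (absorb r _ remainder-e))))
      (Span-map remainder-cong remainder-linear (b ∘ suc) Sy)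

    remainder-bounded : ∀ {x} → norm² x ≤ 1# → norm² (remainder x) ≤ 1#
    remainder-bounded {x} x≤1 = begin
      norm² (remainder x) ≤⟨ x≤y+x _ (*-nonneg (∣∣²-nonneg (coefficient x)) (inj₁ 0<e)) ⟩
      ∣ coefficient x ∣² * norm² e + norm² (remainder x) ≈⟨ norm²-decomposition x ⟨
      norm² x ≤⟨ x≤1 ⟩
      1# ∎

    coefficient-bounded : ∀ {x} → norm² x ≤ 1# → ∣ coefficient x ∣² ≤ q
    coefficient-bounded {x} x≤1 = begin
      ∣ coefficient x ∣²                 ≈⟨ *-identityʳ _ ⟨
      ∣ coefficient x ∣² * 1#            ≈⟨ *-congˡ eq≈1 ⟨
      ∣ coefficient x ∣² * (norm² e * q) ≈⟨ *-assoc _ _ _ ⟨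
      ∣ coefficient x ∣² * norm² e * q   ≤⟨ *-monoˡ-≤ (inj₁ 0<q) (begin
          ∣ coefficient x ∣² * norm² e   ≤⟨ x≤x+y _ (⟨∣⟩-nonneg (remainder x)) ⟩
          ∣ coefficient x ∣² * norm² e + norm² (remainder x) ≈⟨ norm²-decomposition x ⟨
          norm² x                        ≤⟨ x≤1 ⟩
          1#                             ∎) ⟩
      1# * q                             ≈⟨ *-identityˡ q ⟩
      q                                  ∎

    re-bounded : ∀ {x} → norm² x ≤ 1# → re (coefficient x) * re (coefficient x) ≤ q
    re-bounded x≤1 = ≤-trans (x≤x+y _ (square-nonneg _)) (coefficient-bounded x≤1)

    im-bounded : ∀ {x} → norm² x ≤ 1# → im (coefficient x) * im (coefficient x) ≤ q
    im-bounded x≤1 = ≤-trans (x≤y+x _ (square-nonneg _)) (coefficient-bounded x≤1)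

    combined : ∀ x y →
      (re (coefficient x) - re (coefficient y)) * (re (coefficient x) - re (coefficient y)) ≤ δ →
      (im (coefficient x) - im (coefficient y)) * (im (coefficient x) - im (coefficient y)) ≤ δ →
      norm² (remainder x ⊖ remainder y) ≤ ε * ½ →
      norm² (x ⊖ y) ≤ ε
    combined x y re-close im-close remainder-close = begin
      norm² (x ⊖ y)
        ≈⟨ norm²-decomposition (x ⊖ y) ⟩
      ∣ coefficient (x ⊖ y) ∣² * norm² e + norm² (remainder (x ⊖ y))
        ≈⟨ +-cong (*-congʳ (trans (∣∣²-cong (coefficient-linear (-ℂ 1ℂ) y x)) difference))
             (norm²-cong (remainder-linear (-ℂ 1ℂ) y x)) ⟩
      (dr * dr + di * di) * norm² e + norm² (remainder x ⊖ remainder y)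
        ≤⟨ +-mono-≤ (*-monoˡ-≤ (inj₁ 0<e) (+-mono-≤ re-close im-close)) remainder-close ⟩
      (δ + δ) * norm² e + ε * ½
        ≈⟨ RS.solve 4 (λ ε h q n →
             (ε :* h :* (h :* q) :+ ε :* h :* (h :* q)) :* n :+ ε :* h :=
             ε :* h :* (h :+ h) :* (n :* q) :+ ε :* h) refl ε ½ q (norm² e) ⟩
      ε * ½ * (½ + ½) * (norm² e * q) + ε * ½
        ≈⟨ +-congʳ (*-cong (*-congˡ ½+½≈1) eq≈1) ⟩
      ε * ½ * 1# * 1# + ε * ½
        ≈⟨ RS.solve 2 (λ ε h → ε :* h :* con (1 , 0) :* con (1 , 0) :+ ε :* h := ε :* (h :+ h)) refl ε ½ ⟩
      ε * (½ + ½)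
        ≈⟨ *-congˡ ½+½≈1 ⟩
      ε * 1#
        ≈⟨ *-identityʳ ε ⟩
      ε ∎
      where
      open RS using (_:*_; _:+_; _:-_; :-_; _:=_; con)
      dr = re (coefficient x) - re (coefficient y)
      di = im (coefficient x) - im (coefficient y)

      difference : ∣ -ℂ 1ℂ *ℂ coefficient y +ℂ coefficient x ∣² ≈ dr * dr + di * di
      difference = ∣∣²-cong
        ( RS.solve 3 (λ a b c → ((:- con (1 , 0)) :* a :- (:- con (0 , 0)) :* b) :+ c := c :- a) refl
            (re (coefficient y)) (im (coefficient y)) (re (coefficient x))
        , RS.solve 3 (λ a b c → ((:- con (1 , 0)) :* b :+ (:- con (0 , 0)) :* a) :+ c := c :- b) refl
            (re (coefficient y)) (im (coefficient y)) (im (coefficient x)) )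

  -- Powers of a unitary and recurrence

  module _ (U : Unitary H) where
    open Unitary U

    isometry : ∀ x y → ⟨ apply x ∣ apply y ⟩ ≈ℂ ⟨ x ∣ y ⟩
    isometry x y = ℂ-Ring.trans (ℂ-Ring.sym (isAdjoint (apply x) y)) (⟨∣⟩-cong (adjoint-apply x) ≈ᴹ-refl)

    apply-unit : ∀ {x} → IsUnit x → IsUnit (apply x)
    apply-unit x-unit = ℂ-Ring.trans (isometry _ _) x-unit

    power : ℕ → Vector → Vector
    power zero    x = x
    power (suc n) x = apply (power n x)

    power-+ : ∀ m n x → power (m ℕ.+ n) x ≡ power m (power n x)
    power-+ zero    n x = ≡.refl
    power-+ (suc m) n x = ≡.cong apply (power-+ m n x)

    power-isometry : ∀ n x y → ⟨ power n x ∣ power n y ⟩ ≈ℂ ⟨ x ∣ y ⟩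
    power-isometry zero    x y = ℂ-Ring.refl
    power-isometry (suc n) x y = ℂ-Ring.trans (isometry _ _) (power-isometry n x y)

    -- Poincaré recurrence, by the pigeonhole principle for the orbit of x.
    recurrence : ∀ {x δ} → IsUnit x → δ < 1# → ¬ ¬ ∃ λ n → δ ≤ ∣ ⟨ x ∣ power (suc n) x ⟩ ∣²
    recurrence {x} {δ} x-unit δ<1 none with finitelySpanned
    ... | n , b , spans = colouring b (x<y⇒0<y-x δ<1) returns
      where
      open ≤-Reasoning
      in-span : ∀ y → Span b y
      in-span y = let r , y≈ = spans y in Span-resp b (≈ᴹ-sym y≈) (sum∈Span b r)

      unit : ∀ k → IsUnit (power k x)
      unit k = ℂ-Ring.trans (power-isometry k x x) x-unit

      returns : ¬ Colouring b (1# - δ)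
      returns (m , colour , close)
        with pigeonhole (ℕ.n<1+n m) (λ i → colour (power (toℕ i) x))
      -- Writing `j` as `suc i + k` gives the return the positive exponent `suc k`, as a gap between
      -- checkpoints requires.
      ... | i , j , i<j , same with ℕ.m≤n⇒∃[o]m+o≡n i<j
      ...   | k , 1+i+k≡j = none (k , (begin
        -- By `near`, `δ` is at most 2R - 1, and this is at most R² because the square of 1 - R is
        -- nonnegative.
        δ                          ≤⟨ 0≤y-x⇒x≤y (begin
            0#                       ≤⟨ +-nonneg (x≤y⇒0≤y-x near) (square-nonneg (1# - R)) ⟩
            ((1# - δ) - ((1# - R) + (1# - R))) + (1# - R) * (1# - R)
              ≈⟨ RS.solve 2 (λ d r →
                   ((𝟙 :- d) :- ((𝟙 :- r) :+ (𝟙 :- r))) :+ (𝟙 :- r) :* (𝟙 :- r) := r :* r :- d)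
                   refl δ R ⟩
            R * R - δ                ∎) ⟩
        R * R                      ≤⟨ x≤x+y _ (square-nonneg _) ⟩
        ∣ ⟨ u ∣ v ⟩ ∣²             ≈⟨ ∣∣²-cong (⟨∣⟩-cong ≈ᴹ-refl (≈ᴹ-reflexive v≡)) ⟩
        ∣ ⟨ power (toℕ i) x ∣ power (toℕ i) (power (suc k) x) ⟩ ∣²
                                   ≈⟨ ∣∣²-cong (power-isometry (toℕ i) x _) ⟩
        ∣ ⟨ x ∣ power (suc k) x ⟩ ∣² ∎))
        where
        open RS using (_:*_; _:+_; _:-_; _:=_; con)
        𝟙 : ∀ {n} → RS.Polynomial n
        𝟙 = con (1 , 0)
        u = power (toℕ i) x
        v = power (toℕ j) x
        R = re ⟨ u ∣ v ⟩

        bounded : ∀ k → norm² (power k x) ≤ 1#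
        bounded k = ≤-reflexive (unit⇒norm²≈1 (unit k))

        near : (1# - R) + (1# - R) ≤ 1# - δ
        near = ≤-trans (≤-reflexive (sym (norm²-difference (unit (toℕ i)) (unit (toℕ j)))))
          (close u v (in-span u) (in-span v) (bounded (toℕ i)) (bounded (toℕ j)) same)

        v≡ : v ≡ power (toℕ i) (power (suc k) x)
        v≡ = ≡.trans (≡.cong (λ l → power l x) (≡.trans (≡.sym 1+i+k≡j) (≡.sym (ℕ.+-suc (toℕ i) k))))
               (power-+ (toℕ i) (suc k) x)

-- Checkpoint sequences and words with a constant tail

module CheckpointProperties (c : Checkpoints) where
  open Checkpoints c

  at-mono : ∀ {i j} → i ℕ.≤ j → at i ℕ.≤ at j
  at-mono {zero} {zero}  _ = ℕ.≤-refl
  at-mono {i}    {suc j} i≤1+j with ℕ.m≤n⇒m<n∨m≡n i≤1+j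
  ... | inj₁ i<1+j  = ℕ.≤-trans (at-mono (ℕ.≤-pred i<1+j)) (ℕ.<⇒≤ (increasing j))
  ... | inj₂ ≡.refl = ℕ.≤-refl

  ¬checkpoint-before : ∀ {m} → m ℕ.< at 0 → ¬ IsCheckpoint m
  ¬checkpoint-before m<at0 (i , ≡.refl) = ℕ.<⇒≱ m<at0 (at-mono {0} {i} ℕ.z≤n)

  ¬checkpoint-between : ∀ {i m} → at i ℕ.< m → m ℕ.< at (suc i) → ¬ IsCheckpoint m
  ¬checkpoint-between {i} at<m m<at (j , ≡.refl) with j ℕ.≤? i
  ... | yes j≤i = ℕ.<⇒≱ at<m (at-mono j≤i)
  ... | no  j≰i = ℕ.<⇒≱ m<at (at-mono (ℕ.≰⇒> j≰i))

-- The checkpoints n, n + (1 + p), n + 2 (1 + p), …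
periodic : ℕ → ℕ → Checkpoints
periodic n p = record { at = at ; increasing = λ i → ℕ.s≤s (ℕ.m≤n+m (at i) p) }
  where
  at : ℕ → ℕ
  at zero    = n
  at (suc i) = suc (p ℕ.+ at i)

constant : ∀ {k} → Fin k → Word k
constant x _ = x

_↾_then_ : ∀ {k} → Word k → ℕ → Fin k → Word k
(w ↾ n then x) m = if does (m ℕ.<? n) then w m else x

↾-before : ∀ {k} (w : Word k) {n m} x → m ℕ.< n → (w ↾ n then x) m ≡ w m
↾-before w {n} {m} x m<n = ≡.cong (if_then w m else x) (dec-true (m ℕ.<? n) m<n)

↾-after : ∀ {k} (w : Word k) {n m} x → n ℕ.≤ m → (w ↾ n then x) m ≡ x
↾-after w {n} {m} x n≤m = ≡.cong (if_then w m else x) (dec-false (m ℕ.<? n) (ℕ.≤⇒≯ n≤m))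

-- Acceptance by explicit witnesses, and its survival under a constant tail

module Acceptance (ℝ : CompleteOrderedField) where
  open CompleteOrderedField ℝ hiding (zero)
  open OrderedField ℝ
  open Quantum ℝ

  module _ {k : ℕ} (A : QuantumAutomaton k) where
    open QuantumAutomaton A
    open HilbertSpace ℝ H
    open Checkpoints using (at; IsCheckpoint; isCheckpoint?)

    run-at : ∀ w ψ c {m} → IsCheckpoint c m → disturbingRun w ψ c (suc m) ≡ Unitary.apply (U (w m)) ψ
    run-at w ψ c {m} m∈c =
      ≡.cong (λ b → Unitary.apply (U (w m)) (if b then ψ else disturbingRun w ψ c m))
        (dec-true (isCheckpoint? c m) m∈c)

    run-off : ∀ w ψ c {m} → ¬ IsCheckpoint c m →
              disturbingRun w ψ c (suc m) ≡ Unitary.apply (U (w m)) (disturbingRun w ψ c m)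
    run-off w ψ c {m} m∉c =
      ≡.cong (λ b → Unitary.apply (U (w m)) (if b then ψ else disturbingRun w ψ c m))
        (dec-false (isCheckpoint? c m) m∉c)

    run-unit : ∀ w {ψ} c → IsUnit ψ → ∀ m → IsUnit (disturbingRun w ψ c m)
    run-unit w c ψ-unit zero = s₀-unit
    run-unit w c ψ-unit (suc m) with does (isCheckpoint? c m)
    ... | true  = apply-unit (U (w m)) ψ-unit
    ... | false = apply-unit (U (w m)) (run-unit w c ψ-unit m)

    -- The nested suprema and infimum unwound. A uniform `bound` is stored because return
    -- probabilities that all exceed `cut` may still have infimum `cut`.
    record Accepts (cut : Carrier) (w : Word k) : Set where
      field
        ψ           : Vector
        ψ∈F         : Subspace.contains F ψ
        ψ-unit      : IsUnit ψ
        checkpoints : Checkpoints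
        bound       : Carrier
        cut<bound   : cut < bound
        bound≤      : ∀ i → bound ≤ returnProbability w ψ checkpoints i

    -- Membership demands an actual value, so each infimum and supremum is built by completeness;
    -- `cauchy-schwarz` supplies the upper bound 1.
    accepts⇒∈ : ∀ {cut w} → Accepts cut w → language^> cut w
    accepts⇒∈ {cut} {w} accepts = v , v-sup , (begin-strict
      cut   <⟨ cut<bound ⟩
      bound ≤⟨ proj₂ b-inf (λ (i , p≈) → ≤-trans (bound≤ i) (≤-reflexive (sym p≈))) ⟩
      b     ≤⟨ proj₁ a-sup (checkpoints , b-inf) ⟩
      a     ≤⟨ proj₁ v-sup (inj₂ (ψ , ψ∈F , ψ-unit , a-sup)) ⟩
      v     ∎)
      where
      open Accepts accepts
      open ≤-Reasoning

      at-most-1 : ∀ {ψ} c {b} → IsUnit ψ → IsInfimum (λ p → ∃ λ i → p ≈ returnProbability w ψ c i) b → b ≤ 1#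
      at-most-1 c ψ-unit (lower , _) =
        ≤-trans (lower (0 , refl)) (cauchy-schwarz ψ-unit (run-unit w c ψ-unit (at c 0)))

      infimum-b = infimum (λ p → ∃ λ i → p ≈ returnProbability w ψ checkpoints i) (_ , 0 , refl)
        (bound , λ (i , p≈) → ≤-trans (bound≤ i) (≤-reflexive (sym p≈)))
      b     = proj₁ infimum-b
      b-inf = proj₂ infimum-b

      supremum-a = complete
        (λ b → Σ Checkpoints λ c → IsInfimum (λ p → ∃ λ i → p ≈ returnProbability w ψ c i) b)
        (b , checkpoints , b-inf) (1# , λ (c , inf) → at-most-1 c ψ-unit inf)
      a     = proj₁ supremum-a
      a-sup = proj₂ supremum-a

      value : ∃ (IsValue w)
      value = complete _ (0# , inj₁ refl) (1# , λ where
        (inj₁ a≈0)                       → ≤-trans (≤-reflexive a≈0) (inj₁ 0<1)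
        (inj₂ (_ , _ , unit , _ , least)) → least (λ (c , inf) → at-most-1 c unit inf))
      v     = proj₁ value
      v-sup = proj₂ value

    -- Descends through both suprema by `<-supremum`. A nonnegative `cut` excludes the adjoined
    -- value 0.
    ∈⇒accepts : ∀ {cut w} → 0# ≤ cut → language^> cut w → ¬ ¬ Accepts cut w
    ∈⇒accepts 0≤cut (v , v-sup , cut<v) none = <-supremum v-sup cut<v λ where
      (a , inj₁ a≈0 , cut<a) → <⇒≱ cut<a (≤-trans (≤-reflexive a≈0) 0≤cut)
      (a , inj₂ (ψ , ψ∈F , ψ-unit , a-sup) , cut<a) → <-supremum a-sup cut<a
        λ (b , (c , lower , _) , cut<b) → none (record
          { ψ = ψ ; ψ∈F = ψ∈F ; ψ-unit = ψ-unit ; checkpoints = c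
          ; bound = b ; cut<bound = cut<b ; bound≤ = λ i → lower (i , refl) })

    -- Keep the prefix up to the first checkpoint n; after it, recurrence of U x
    -- provides a period at which ψ almost returns to itself.
    accepts-constant-tail : ∀ {cut w} x → cut < 1# → Accepts cut w →
                            ¬ ¬ ∃ λ n → Accepts cut (w ↾ n then x)
    accepts-constant-tail {cut} {w} x cut<1 accepts none =
      recurrence (U x) ψ-unit δ<1 λ (p , δ≤) → none (n , record
      { ψ = ψ ; ψ∈F = ψ∈F ; ψ-unit = ψ-unit ; checkpoints = periodic n p
      ; bound = r ; cut<bound = r-max cut<bound cut<δ ; bound≤ = returns p δ≤ })
      where
      open Accepts accepts
      n  = at checkpoints 0

      -- Recurrence reaches any level below 1, so a level strictly above `cut` is fixed first.
      δ     = proj₁ (between cut<1)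
      cut<δ = proj₁ (proj₂ (between cut<1))
      δ<1   = proj₂ (proj₂ (between cut<1))

      -- The old bound covers the first checkpoint, whose prefix is kept; `δ` covers all later ones.
      r       = proj₁ (lesser bound δ)
      r≤bound = proj₁ (proj₂ (lesser bound δ))
      r≤δ     = proj₁ (proj₂ (proj₂ (lesser bound δ)))
      r-max   = proj₂ (proj₂ (proj₂ (lesser bound δ)))

      w′ = w ↾ n then x

      module _ (p : ℕ) where
        c′ = periodic n p
        run′ = disturbingRun w′ ψ c′

        same-prefix : ∀ m → m ℕ.≤ n → run′ m ≡ disturbingRun w ψ checkpoints m
        same-prefix zero    _   = ≡.refl
        same-prefix (suc m) m<n = begin
          run′ (suc m)
            ≡⟨ run-off w′ ψ c′ (CheckpointProperties.¬checkpoint-before c′ m<n) ⟩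
          Unitary.apply (U (w′ m)) (run′ m)
            ≡⟨ ≡.cong₂ (λ l → Unitary.apply (U l)) (↾-before w x m<n) (same-prefix m (ℕ.<⇒≤ m<n)) ⟩
          Unitary.apply (U (w m)) (disturbingRun w ψ checkpoints m)
            ≡⟨ run-off w ψ checkpoints (CheckpointProperties.¬checkpoint-before checkpoints m<n) ⟨
          disturbingRun w ψ checkpoints (suc m) ∎
          where open ≡-Reasoning

        tail-letter : ∀ i j → w′ (j ℕ.+ at c′ i) ≡ x
        tail-letter i j =
          ↾-after w x (ℕ.≤-trans (CheckpointProperties.at-mono c′ {0} {i} ℕ.z≤n) (ℕ.m≤n+m (at c′ i) j))

        -- The reset precedes the letter read at the checkpoint, hence `suc j` applications. For `j`
        -- equal to `p` the position is `at c′ (suc i)` by definition, so this is the state at the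
        -- next checkpoint.
        block : ∀ i j → j ℕ.≤ p → run′ (suc (j ℕ.+ at c′ i)) ≡ power (U x) (suc j) ψ
        block i zero    _   = ≡.trans (run-at w′ ψ c′ (i , ≡.refl))
          (≡.cong (λ l → Unitary.apply (U l) ψ) (tail-letter i 0))
        block i (suc j) j<p = ≡.trans
          (run-off w′ ψ c′ (CheckpointProperties.¬checkpoint-between c′ {i}
            (ℕ.s≤s (ℕ.m≤n+m (at c′ i) j)) (ℕ.s≤s (ℕ.+-monoˡ-≤ (at c′ i) j<p))))
          (≡.cong₂ (λ l → Unitary.apply (U l)) (tail-letter i (suc j)) (block i j (ℕ.<⇒≤ j<p)))

        returns : δ ≤ ∣ ⟨ ψ ∣ power (U x) (suc p) ψ ⟩ ∣² → ∀ i → r ≤ returnProbability w′ ψ c′ i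
        returns δ≤ zero = begin
          r                                    ≤⟨ r≤bound ⟩
          bound                                ≤⟨ bound≤ 0 ⟩
          returnProbability w ψ checkpoints 0  ≡⟨ ≡.cong (λ s → ∣ ⟨ ψ ∣ s ⟩ ∣²) (same-prefix n ℕ.≤-refl) ⟨
          returnProbability w′ ψ c′ 0          ∎
          where open ≤-Reasoning
        returns δ≤ (suc i) = begin
          r                                    ≤⟨ r≤δ ⟩
          δ                                    ≤⟨ δ≤ ⟩
          ∣ ⟨ ψ ∣ power (U x) (suc p) ψ ⟩ ∣²   ≡⟨ ≡.cong (λ s → ∣ ⟨ ψ ∣ s ⟩ ∣²) (block i p ℕ.≤-refl) ⟨
          returnProbability w′ ψ c′ (suc i)    ∎
          where open ≤-Reasoning

    constant-tail : ∀ {cut w} x → 0# ≤ cut → cut < 1# → language^> cut w →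
                    ¬ ¬ ∃ λ n → language^> cut (w ↾ n then x)
    constant-tail x 0≤cut cut<1 w∈L none = ∈⇒accepts 0≤cut w∈L λ accepts →
      accepts-constant-tail x cut<1 accepts λ (n , accepts′) → none (n , accepts⇒∈ accepts′)

-- The two swap automata on the plane

module SwapAutomaton (ℝ : CompleteOrderedField) where
  open CompleteOrderedField ℝ hiding (zero)
  open OrderedField ℝ
  open Quantum ℝ
  open ComplexProperties ℝ
  open Acceptance ℝ
  private
    module ℂ-Ring = CommutativeRing ℂ-commutativeRing
    module RS = IntegerCoefficients commutativeRing
    module CS = IntegerCoefficients ℂ-commutativeRing

  plane : FiniteDimensionalHilbertSpace
  plane = record
    { vectorSpace     = DirectProduct.leftModule TensorUnit.leftModule TensorUnit.leftModule
    ; ⟨_∣_⟩           = ⟨_∣_⟩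
    ; ⟨∣⟩-cong        = λ (p , q) (p′ , q′) →
        ℂ-Ring.+-cong (ℂ-Ring.*-cong (conj-cong p) p′) (ℂ-Ring.*-cong (conj-cong q) q′)
    ; ⟨∣⟩-+           = λ (x₁ , x₂) (y₁ , y₂) (z₁ , z₂) →
        CS.solve 6 (λ x₁ x₂ y₁ y₂ z₁ z₂ →
            x₁ :* (y₁ :+ z₁) :+ x₂ :* (y₂ :+ z₂) := (x₁ :* y₁ :+ x₂ :* y₂) :+ (x₁ :* z₁ :+ x₂ :* z₂))
          ℂ-Ring.refl (conj x₁) (conj x₂) y₁ y₂ z₁ z₂
    ; ⟨∣⟩-*           = λ (x₁ , x₂) c (y₁ , y₂) →
        CS.solve 5 (λ x₁ x₂ c y₁ y₂ → x₁ :* (c :* y₁) :+ x₂ :* (c :* y₂) := c :* (x₁ :* y₁ :+ x₂ :* y₂))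
          ℂ-Ring.refl (conj x₁) (conj x₂) c y₁ y₂
    ; ⟨∣⟩-conj        = λ (x₁ , x₂) (y₁ , y₂) → ℂ-Ring.trans
        (ℂ-Ring.+-cong (conj-conj-* x₁ y₁) (conj-conj-* x₂ y₂))
        (ℂ-Ring.sym (conj-+ (conj x₁ *ℂ y₁) (conj x₂ *ℂ y₂)))
    ; ⟨∣⟩-nonneg      = λ x → ≤-trans
        (+-nonneg (∣∣²-nonneg (proj₁ x)) (∣∣²-nonneg (proj₂ x))) (≤-reflexive (sym (norm² x)))
    ; ⟨∣⟩-definite    = λ {x} ⟨x∣x⟩≈0 →
        let sum≈0 = trans (sym (norm² x)) (re≈ ⟨x∣x⟩≈0)
        in ∣∣²-definite (proj₁ x) sum≈0 (∣∣²-nonneg (proj₂ x)) ,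
           ∣∣²-definite (proj₂ x) (trans (+-comm _ _) sum≈0) (∣∣²-nonneg (proj₁ x))
    ; finitelySpanned = 2 , (λ { zero → 1ℂ , 0ℂ ; (suc zero) → 0ℂ , 1ℂ }) , λ (x₁ , x₂) →
        (λ { zero → x₁ ; (suc zero) → x₂ }) ,
        CS.solve 2 (λ x₁ x₂ → x₁ := x₁ :* 𝟙 :+ (x₂ :* 𝟘 :+ 𝟘)) ℂ-Ring.refl x₁ x₂ ,
        CS.solve 2 (λ x₁ x₂ → x₂ := x₁ :* 𝟘 :+ (x₂ :* 𝟙 :+ 𝟘)) ℂ-Ring.refl x₁ x₂
    }
    where
    open CS using (_:+_; _:*_; _:=_)
    𝟘 𝟙 : ∀ {n} → CS.Polynomial n
    𝟘 = CS.con (0 , 0)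
    𝟙 = CS.con (1 , 0)

    ⟨_∣_⟩ : ℂ × ℂ → ℂ × ℂ → ℂ
    ⟨ x₁ , x₂ ∣ y₁ , y₂ ⟩ = conj x₁ *ℂ y₁ +ℂ conj x₂ *ℂ y₂

    norm² : ∀ x → re ⟨ x ∣ x ⟩ ≈ ∣ proj₁ x ∣² + ∣ proj₂ x ∣²
    norm² (x₁ , x₂) = +-cong (re-conj-* x₁) (re-conj-* x₂)

  open FiniteDimensionalHilbertSpace plane

  letter : Fin 2 → Unitary plane
  letter zero = record
    { apply         = swap
    ; adjoint       = swap
    ; linear        = record
      { +ᴹ-isGroupHomomorphism = record
        { isMonoidHomomorphism = record
          { isMagmaHomomorphism = record
            { isRelHomomorphism = record { cong = swap }
            ; homo = λ _ _ → ≈ᴹ-refl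
            }
          ; ε-homo = ≈ᴹ-refl
          }
        ; ⁻¹-homo = λ _ → ≈ᴹ-refl
        }
      ; *ₗ-homo = λ _ _ → ≈ᴹ-refl
      }
    ; isAdjoint     = λ _ _ → ℂ-Ring.+-comm _ _
    ; adjoint-apply = λ _ → ≈ᴹ-refl
    ; apply-adjoint = λ _ → ≈ᴹ-refl
    }
  letter (suc zero) = record
    { apply         = id
    ; adjoint       = id
    ; linear        = record
      { +ᴹ-isGroupHomomorphism = record
        { isMonoidHomomorphism = record
          { isMagmaHomomorphism = record
            { isRelHomomorphism = record { cong = id }
            ; homo = λ _ _ → ≈ᴹ-refl
            }
          ; ε-homo = ≈ᴹ-refl
          }
        ; ⁻¹-homo = λ _ → ≈ᴹ-refl
        }
      ; *ₗ-homo = λ _ _ → ≈ᴹ-refl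
      }
    ; isAdjoint     = λ _ _ → ℂ-Ring.refl
    ; adjoint-apply = λ _ → ≈ᴹ-refl
    ; apply-adjoint = λ _ → ≈ᴹ-refl
    }

  coordinate : Bool → Vector → ℂ
  coordinate false = proj₁
  coordinate true  = proj₂

  basis : Bool → Vector
  basis false = 1ℂ , 0ℂ
  basis true  = 0ℂ , 1ℂ

  basis-unit : ∀ q → IsUnit (basis q)
  basis-unit q = unit q
    where
    open RS using (_:+_; _:*_; _:-_; :-_; _:=_)
    𝟘 𝟙 : RS.Polynomial 0
    𝟘 = RS.con (0 , 0)
    𝟙 = RS.con (1 , 0)
    unit : ∀ q → IsUnit (basis q)
    unit false = RS.solve 0 ((𝟙 :* 𝟙 :- (:- 𝟘) :* 𝟘) :+ (𝟘 :* 𝟘 :- (:- 𝟘) :* 𝟘) := 𝟙) refl ,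
                 RS.solve 0 ((𝟙 :* 𝟘 :+ (:- 𝟘) :* 𝟙) :+ (𝟘 :* 𝟘 :+ (:- 𝟘) :* 𝟘) := 𝟘) refl
    unit true  = RS.solve 0 ((𝟘 :* 𝟘 :- (:- 𝟘) :* 𝟘) :+ (𝟙 :* 𝟙 :- (:- 𝟘) :* 𝟘) := 𝟙) refl ,
                 RS.solve 0 ((𝟘 :* 𝟘 :+ (:- 𝟘) :* 𝟘) :+ (𝟙 :* 𝟘 :+ (:- 𝟘) :* 𝟙) := 𝟘) refl

  basis-orthogonal : ∀ q → coordinate (not q) (basis q) ≈ℂ 0ℂ
  basis-orthogonal false = ℂ-Ring.refl
  basis-orthogonal true  = ℂ-Ring.refl

  orthogonal : ∀ q {x y} → coordinate (not q) x ≈ℂ 0ℂ → coordinate q y ≈ℂ 0ℂ → ⟨ x ∣ y ⟩ ≈ℂ 0ℂ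
  orthogonal false {x} {y} x≈0 y≈0 = ℂ-Ring.trans
    (ℂ-Ring.+-cong (ℂ-Ring.trans (ℂ-Ring.*-congˡ y≈0) (ℂ-Ring.zeroʳ (conj (proj₁ x))))
      (conj-0-* (proj₂ y) x≈0))
    (ℂ-Ring.+-identityˡ 0ℂ)
  orthogonal true {x} {y} x≈0 y≈0 = ℂ-Ring.trans
    (ℂ-Ring.+-cong (conj-0-* (proj₁ y) x≈0)
      (ℂ-Ring.trans (ℂ-Ring.*-congˡ y≈0) (ℂ-Ring.zeroʳ (conj (proj₂ x)))))
    (ℂ-Ring.+-identityˡ 0ℂ)

  -- The line through `basis q`, described by an equation on the other coordinate.
  axis : Bool → Subspace plane
  axis q = record
    { contains  = λ x → coordinate (not q) x ≈ℂ 0ℂ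
    ; resp-≈ᴹ   = resp (not q)
    ; has-0ᴹ    = zero∈ (not q)
    ; +ᴹ-closed = add (not q)
    ; *ₗ-closed = scale (not q)
    }
    where
    resp : ∀ q {x y} → x ≈ᴹ y → coordinate q x ≈ℂ 0ℂ → coordinate q y ≈ℂ 0ℂ
    resp false (x≈y , _) x≈0 = ℂ-Ring.trans (ℂ-Ring.sym x≈y) x≈0
    resp true  (_ , x≈y) x≈0 = ℂ-Ring.trans (ℂ-Ring.sym x≈y) x≈0

    zero∈ : ∀ q → coordinate q 0ᴹ ≈ℂ 0ℂ
    zero∈ false = ℂ-Ring.refl
    zero∈ true  = ℂ-Ring.refl

    add : ∀ q {x y} → coordinate q x ≈ℂ 0ℂ → coordinate q y ≈ℂ 0ℂ → coordinate q (x +ᴹ y) ≈ℂ 0ℂ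
    add false x≈0 y≈0 = ℂ-Ring.trans (ℂ-Ring.+-cong x≈0 y≈0) (ℂ-Ring.+-identityˡ 0ℂ)
    add true  x≈0 y≈0 = ℂ-Ring.trans (ℂ-Ring.+-cong x≈0 y≈0) (ℂ-Ring.+-identityˡ 0ℂ)

    scale : ∀ q c {x} → coordinate q x ≈ℂ 0ℂ → coordinate q (c *ₗ x) ≈ℂ 0ℂ
    scale false c x≈0 = ℂ-Ring.trans (ℂ-Ring.*-congˡ x≈0) (ℂ-Ring.zeroʳ c)
    scale true  c x≈0 = ℂ-Ring.trans (ℂ-Ring.*-congˡ x≈0) (ℂ-Ring.zeroʳ c)

  automaton : Bool → QuantumAutomaton 2
  automaton q = record { H = plane ; s₀ = basis false ; s₀-unit = basis-unit false ; U = letter ; F = axis q }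

  step : Fin 2 → Bool → Bool
  step zero       = not
  step (suc zero) = id

  -- The parity of the number of letters 0 read so far, which is the index of the basis vector
  -- reached without resets.
  path : Word 2 → ℕ → Bool
  path w zero    = false
  path w (suc m) = step (w m) (path w m)

  letter-basis : ∀ l q → Unitary.apply (letter l) (basis q) ≡ basis (step l q)
  letter-basis zero       false = ≡.refl
  letter-basis zero       true  = ≡.refl
  letter-basis (suc zero) q     = ≡.refl

  letter-axis : ∀ l q {x} → coordinate (not q) x ≈ℂ 0ℂ →
                coordinate (not (step l q)) (Unitary.apply (letter l) x) ≈ℂ 0ℂ
  letter-axis zero       false x≈0 = x≈0
  letter-axis zero       true  x≈0 = x≈0
  letter-axis (suc zero) q     x≈0 = x≈0

  module _ (f : Bool) {cut : Carrier} {w : Word 2} where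
    open QuantumAutomaton (automaton f) using (disturbingRun; returnProbability)
    open Checkpoints using (at; isCheckpoint?; IsCheckpoint)

    -- A reset to `basis f` at a moment when the run is already there changes nothing, so every
    -- return is certain.
    visits⇒accepts : cut < 1# → (c : Checkpoints) → (∀ i → path w (at c i) ≡ f) → Accepts (automaton f) cut w
    visits⇒accepts cut<1 c visits = record
      { ψ = basis f ; ψ∈F = basis-orthogonal f ; ψ-unit = basis-unit f ; checkpoints = c
      ; bound = 1# ; cut<bound = cut<1 ; bound≤ = λ i → ≤-reflexive (sym (certain i)) }
      where
      state : ∀ m → disturbingRun w (basis f) c m ≡ basis (path w m)
      state zero = ≡.refl
      state (suc m) with isCheckpoint? c m
      ... | no  m∉c = ≡.trans (run-off (automaton f) w (basis f) c m∉c)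
        (≡.trans (≡.cong (Unitary.apply (letter (w m))) (state m)) (letter-basis (w m) _))
      ... | yes (i , ≡.refl) = ≡.trans (run-at (automaton f) w (basis f) c (i , ≡.refl))
        (≡.trans (≡.cong (λ q → Unitary.apply (letter (w m)) (basis q)) (≡.sym (visits i)))
          (letter-basis (w m) _))

      certain : ∀ i → returnProbability w (basis f) c i ≈ 1#
      certain i = begin-equality
        returnProbability w (basis f) c i
          ≡⟨ ≡.cong (λ s → ∣ ⟨ basis f ∣ s ⟩ ∣²) (≡.trans (state (at c i)) (≡.cong basis (visits i))) ⟩
        ∣ ⟨ basis f ∣ basis f ⟩ ∣²
          ≈⟨ ∣∣²-cong (basis-unit f) ⟩
        1# * 1# + 0# * 0#
          ≈⟨ +-cong (*-identityˡ 1#) (zeroˡ 0#) ⟩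
        1# + 0#
          ≈⟨ +-identityʳ 1# ⟩
        1# ∎
        where open ≤-Reasoning

    -- A zero return probability is excluded, so every reset puts the run on the axis it was on anyway.
    accepts⇒visits : 0# ≤ cut → (accepts : Accepts (automaton f) cut w) →
                     ∀ i → path w (at (Accepts.checkpoints accepts) i) ≡ f
    accepts⇒visits 0≤cut accepts i = visits i ≡.refl (state (at checkpoints i))
      where
      open Accepts accepts

      run : ℕ → Vector
      run = disturbingRun w ψ checkpoints

      -- The axis condition is an argument so that `state` can invoke this at `m` and still recurse
      -- structurally.
      visits : ∀ i {m} → at checkpoints i ≡ m → coordinate (not (path w m)) (run m) ≈ℂ 0ℂ → path w m ≡ f
      visits i {m} ≡.refl on-axis with path w m Bool.≟ f
      ... | yes q≡f = q≡f
      ... | no  q≢f = contradiction (begin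
        bound                                ≤⟨ bound≤ i ⟩
        returnProbability w ψ checkpoints i  ≈⟨ ∣∣²-cong (orthogonal f {ψ} {run m} ψ∈F on-other-axis) ⟩
        0# * 0# + 0# * 0#                    ≈⟨ +-cong (zeroˡ 0#) (zeroˡ 0#) ⟩
        0# + 0#                              ≈⟨ +-identityˡ 0# ⟩
        0#                                   ≤⟨ 0≤cut ⟩
        cut                                  ∎) (<⇒≱ cut<bound)
        where
        open ≤-Reasoning
        on-other-axis : coordinate f (run m) ≈ℂ 0ℂ
        on-other-axis = ≡.subst (λ q → coordinate q (run m) ≈ℂ 0ℂ)
          (≡.trans (≡.cong not (Bool.¬-not q≢f)) (Bool.not-involutive f)) on-axis

      -- The accepting ψ may differ from `basis f` by a phase, so the invariant fixes an axis
      -- instead of a vector.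
      state : ∀ m → coordinate (not (path w m)) (run m) ≈ℂ 0ℂ
      state zero = ℂ-Ring.refl
      state (suc m) with isCheckpoint? checkpoints m
      ... | no  m∉c = ≡.subst (λ s → coordinate (not (path w (suc m))) s ≈ℂ 0ℂ)
        (≡.sym (run-off (automaton f) w ψ checkpoints m∉c)) (letter-axis (w m) (path w m) (state m))
      ... | yes (i , at≡m) = ≡.subst (λ s → coordinate (not (path w (suc m))) s ≈ℂ 0ℂ)
        (≡.sym (run-at (automaton f) w ψ checkpoints (i , at≡m)))
        (letter-axis (w m) (path w m)
          (≡.subst (λ q → coordinate (not q) ψ ≈ℂ 0ℂ) (≡.sym (visits i at≡m (state m))) ψ∈F))

  path-constant-1 : ∀ m → path (constant (suc zero)) m ≡ false
  path-constant-1 zero    = ≡.refl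
  path-constant-1 (suc m) = path-constant-1 m

  path-↾-before : ∀ w n x {m} → m ℕ.≤ n → path (w ↾ n then x) m ≡ path w m
  path-↾-before w n x {zero}  _   = ≡.refl
  path-↾-before w n x {suc m} m<n = ≡.cong₂ step (↾-before w x m<n) (path-↾-before w n x (ℕ.<⇒≤ m<n))

  path-↾-after : ∀ w n x {m} → n ℕ.≤ m → path (w ↾ n then x) (suc m) ≡ step x (path (w ↾ n then x) m)
  path-↾-after w n x {m} n≤m = ≡.cong (λ l → step l (path (w ↾ n then x) m)) (↾-after w x n≤m)

  path-then-1 : ∀ w n m → path (w ↾ n then suc zero) (m ℕ.+ n) ≡ path w n
  path-then-1 w n zero    = path-↾-before w n _ ℕ.≤-refl
  path-then-1 w n (suc m) = ≡.trans (path-↾-after w n _ (ℕ.m≤n+m n m)) (path-then-1 w n m)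

  -- The 0 following the ones makes the parity odd at position `suc n`; two further 0s restore it,
  -- hence gaps of 2.
  path-then-0 : ∀ n i → path (constant (suc zero) ↾ n then zero) (Checkpoints.at (periodic (suc n) 1) i) ≡ true
  path-then-0 n zero = ≡.trans (path-↾-after _ n zero ℕ.≤-refl)
    (≡.cong not (≡.trans (path-↾-before _ n zero ℕ.≤-refl) (path-constant-1 n)))
  path-then-0 n (suc i) = ≡.trans
    (≡.trans (path-↾-after _ n zero (ℕ.m≤n⇒m≤1+n n≤at))
      (≡.trans (≡.cong not (path-↾-after _ n zero n≤at)) (Bool.not-involutive _)))
    (path-then-0 n i)
    where
    n≤at : n ℕ.≤ Checkpoints.at (periodic (suc n) 1) i
    n≤at = ℕ.≤-trans (ℕ.n≤1+n n) (CheckpointProperties.at-mono (periodic (suc n) 1) {0} {i} ℕ.z≤n)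

  -- The two counterexamples

  module _ {cut : Carrier} (0≤cut : 0# ≤ cut) (cut<1 : cut < 1#) where
    private
      language : Bool → Language 2
      language f = QuantumAutomaton.language^> (automaton f) cut

    0^ω∈language : ∀ f → language f (constant zero)
    0^ω∈language f = accepts⇒∈ (automaton f) (visits⇒accepts f cut<1 (periodic (start f) 1) (visits f))
      where
      -- On 0^ω the parity is that of the position: the checkpoints are the even positions for
      -- `false` and the odd ones for `true`.
      start : Bool → ℕ
      start false = 0
      start true  = 1

      visits : ∀ f i → path (constant zero) (Checkpoints.at (periodic (start f) 1) i) ≡ f
      visits false zero    = ≡.refl
      visits true  zero    = ≡.refl
      visits f     (suc i) = ≡.trans (Bool.not-involutive _) (visits f i)

    accepts-then-1 : ∀ f w n → Accepts (automaton f) cut (w ↾ n then suc zero) → path w n ≡ f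
    accepts-then-1 f w n accepts = begin
      path w n                              ≡⟨ path-then-1 w n (at n ℕ.∸ n) ⟨
      path w′ (at n ℕ.∸ n ℕ.+ n)            ≡⟨ ≡.cong (path w′) (ℕ.m∸n+n≡m (i≤at n)) ⟩
      path w′ (at n)                        ≡⟨ accepts⇒visits f 0≤cut accepts n ⟩
      f                                     ∎
      where
      open ≡-Reasoning
      open Checkpoints (Accepts.checkpoints accepts)
      w′ = w ↾ n then suc zero

    ¬intersection : ¬ ClosedUnderIntersection (QBA-D^> cut)
    ¬intersection closed
      with closed (language false) (language true) (automaton false , id , id) (automaton true , id , id)
    ... | A , into , out =
      constant-tail A (suc zero) 0≤cut cut<1 (into (0^ω∈language false , 0^ω∈language true)) λ (n , 0ⁿ1^ω∈A) →
      ∈⇒accepts (automaton false) 0≤cut (proj₁ (out 0ⁿ1^ω∈A)) λ accepts₀ →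
      ∈⇒accepts (automaton true) 0≤cut (proj₂ (out 0ⁿ1^ω∈A)) λ accepts₁ →
      -- Acceptance by both automata would give the prefix of length `n` both parities.
      contradiction (≡.trans
        (≡.sym (accepts-then-1 false (constant zero) n accepts₀))
        (accepts-then-1 true (constant zero) n accepts₁)) λ ()

    1^ω∉language : ¬ language true (constant (suc zero))
    1^ω∉language 1^ω∈L = ∈⇒accepts (automaton true) 0≤cut 1^ω∈L λ accepts →
      contradiction (≡.trans
        (≡.sym (path-constant-1 (Checkpoints.at (Accepts.checkpoints accepts) 0)))
        (accepts⇒visits true 0≤cut accepts 0)) λ ()

    ¬complementation : ¬ ClosedUnderComplementation (QBA-D^> cut)
    ¬complementation closed with closed (language true) (automaton true , id , id)
    ... | A , into , out =
      constant-tail A zero 0≤cut cut<1 (into 1^ω∉language) λ (n , 1ⁿ0^ω∈A) →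
      out 1ⁿ0^ω∈A (accepts⇒∈ (automaton true) (visits⇒accepts true cut<1 (periodic (suc n) 1) (path-then-0 n)))

theorem11 :
    (ℝ : CompleteOrderedField) →
    let open CompleteOrderedField ℝ
        open Quantum ℝ
    in (∀ cut → 0# ≤ cut → cut < 1# → ¬ ClosedUnderIntersection (QBA-D^> cut))
       × (∀ cut → 0# ≤ cut → cut < 1# → ¬ ClosedUnderComplementation (QBA-D^> cut))
theorem11 ℝ = (λ cut → ¬intersection {cut}) , (λ cut → ¬complementation {cut})
  where open SwapAutomaton ℝ
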